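{- Let $m\ge 1$ and $h\ge 2$ be integers. The function $\phi$ induces an injection from the open regions of the inside-out polytope $Q=\Delta_{m-1}\setminus\bigcup_{H\in\mathcal{H}_{m,h}}H$ to the coherent acyclic orientations of the graph $\Gamma_{m,h}$. That is, for $\mathbf{z}\in Q$ the orientation $\phi(\mathbf{z})$ is a coherent acyclic orientation of $\Gamma_{m,h}$ depending only on the region containing $\mathbf{z}$, and points in different regions have different images.
   Context: Notation: $[m]=\{1,\dots,m\}$, $\mathbb{N}=\{0,1,2,\dots\}$, and $\Delta_{m-1}=\{\mathbf{z}\in\mathbb{R}^m: z_1,\dots,z_m\ge 0,\ \sum_{i=1}^m z_i=1\}$. A consecutive subset of $[m]$ is a nonempty set of the form $\{j,j+1,\dots,k\}$; it is proper if it is not equal to $[m]$. Arrangement: $\mathcal{H}_{m,h}$ is the set of all nondegenerate hyperplanes of $\mathbb{R}^m$ (i.e. the equation is not identically satisfied) of the form $$\sum_{k=1}^{\ell}\Big(\sum_{j\in U_k}z_j\Big)=\sum_{k=\ell+1}^{h'}\Big(\sum_{j\in U_k}z_j\Big),$$ where $0\le \ell\le h'\le h$ and $U_1,\dots,U_{h'}$ are (not necessarily distinct) proper consecutive subsets of $[m]$; empty sums are $0$. A region is a connected component of $Q=\Delta_{m-1}\setminus\bigcup_{H\in\mathcal{H}_{m,h}}H$, and an open region is the relative interior of a region. Climb: for $\mathbf{a}=(a_1,\dots,a_m)\in\mathbb{N}^m$, with $a_0:=0$, $\operatorname{climb}(\mathbf{a})=\sum_{j=1}^m\operatorname{climb}_j(\mathbf{a})$,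 where $\operatorname{climb}_j(\mathbf{a})=a_j-a_{j-1}$ if $a_{j-1}<a_j$ and $0$ otherwise. The support of $\mathbf{a}$ is $\operatorname{supp}(\mathbf{a})=\{i:a_i\neq 0\}$. Graph: $M_h$ is the (finite) set of vectors in $\mathbb{N}^m$ of climb at most $h$. $\Gamma_{m,h}$ is the undirected graph with vertex set $M_h$ in which two distinct vertices $\mathbf{u},\mathbf{v}$ form an edge if, when we write $\mathbf{u}=\mathbf{a}+\mathbf{c}$, $\mathbf{v}=\mathbf{b}+\mathbf{c}$ with $\mathbf{a},\mathbf{b},\mathbf{c}\in\mathbb{N}^m$ and $\operatorname{supp}(\mathbf{a})\cap\operatorname{supp}(\mathbf{b})=\emptyset$ (this is possible in a unique way), we have $\operatorname{climb}(\mathbf{a})+\operatorname{climb}(\mathbf{b})\le h$. Coherence: an orientation of all edges of $\Gamma_{m,h}$ is coherent if (i) every edge $\mathbf{0}\mathbf{u}$ is oriented from $\mathbf{0}$ to $\mathbf{u}$, and (ii) for all distinct $\mathbf{a},\mathbf{b}\in\mathbb{N}^m$ with $\operatorname{climb}(\mathbf{a})+\operatorname{climb}(\mathbf{b})\le h$ and every $\mathbf{c}\in\mathbb{N}^m$ such that $\mathbf{u}=\mathbf{a}+\mathbf{c}$ and $\mathbf{v}=\mathbf{b}+\mathbf{c}$ belong to $M_h$, the orientation of $\mathbf{u}\mathbf{v}$ agrees with that of $\mathbf{a}\mathbf{b}$ (that is, $\mathbf{u}\to\mathbf{v}$ if and only if $\mathbf{a}\to\mathbf{b}$). It is acyclic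 if it has no directed cycle. The map $\phi$: for $\mathbf{z}=(z_1,\dots,z_m)\in Q$, $\phi(\mathbf{z})$ orients each edge $\mathbf{u}\mathbf{v}$ of $\Gamma_{m,h}$ as $\mathbf{u}\to\mathbf{v}$ if $\sum_{i=1}^m u_iz_i<\sum_{i=1}^m v_iz_i$. -}

module Defs where

open import Algebra.Bundles.Raw using (RawMonoid)
import Algebra.Definitions.RawMonoid as RawMonoidOps
open import Data.Bool.Base using (if_then_else_)
open import Data.Fin.Base as Fin using (Fin)
open import Data.Fin.Subset using (Subset; ⊤; _∈_)
open import Data.List.Base using (List; length; foldr)
open import Data.List.Relation.Unary.All using (All)
open import Data.Nat.Base as ℕ using (ℕ)
import Data.Nat.Properties as ℕₚ
open import Data.Product using (Σ; ∃; ∃₂; ∃-syntax; Σ-syntax; _×_; _,_; proj₁; proj₂)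
open import Data.Rational.Base as ℚ using (ℚ; 0ℚ; 1ℚ; ½; ∣_∣)
import Data.Rational.Properties as ℚₚ
open import Data.Rational.Solver using (module +-*-Solver)
open import Data.Sum.Base using (_⊎_)
open import Data.Vec.Base as Vec using (Vec; []; _∷_; lookup; zipWith; replicate)
open import Data.Vec.Functional using (Vector)
open import Function.Base using (_on_)
import Function.Bundles as Fun
open import Level using (Level; 0ℓ; suc; _⊔_)
open import Relation.Binary.Bundles using (Setoid)
open import Relation.Binary.Core using (Rel; _⇔_)
open import Relation.Binary.Construct.Closure.Transitive using (TransClosure)
import Relation.Binary.Construct.On as On
open import Relation.Binary.PropositionalEquality
  using (_≡_; _≢_; refl; sym; cong; subst)
open import Relation.Nullary.Negation using (¬_)
open import Relation.Unary as U using (Pred; _⊆_; _∪_; _∩_; _≬_; _≐_)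
open import Relation.Unary.Relation.Binary.Equality using (≐-setoid)

-- The library has no real numbers; they are taken as Cauchy sequences of
-- rationals with moduli, compared by the setoid equality _≈ᴿ_.
record ℝ : Set where
  constructor mkℝ
  field
    seq    : ℕ → ℚ
    cauchy : ∀ ε → 0ℚ ℚ.< ε →
             ∃[ N ] ∀ m n → N ℕ.≤ m → N ℕ.≤ n → ∣ seq m ℚ.- seq n ∣ ℚ.< ε

open ℝ public

infix 4 _≈ᴿ_ _<ᴿ_ _≤ᴿ_ _#_

_≈ᴿ_ _<ᴿ_ _≤ᴿ_ : Rel ℝ 0ℓ
x ≈ᴿ y = ∀ ε → 0ℚ ℚ.< ε → ∃[ N ] ∀ n → N ℕ.≤ n → ∣ seq x n ℚ.- seq y n ∣ ℚ.< ε
x <ᴿ y = ∃[ ε ] 0ℚ ℚ.< ε × ∃[ N ] ∀ n → N ℕ.≤ n → seq x n ℚ.+ ε ℚ.< seq y n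
x ≤ᴿ y = ¬ (y <ᴿ x)

-- Being unequal as real numbers, in its constructive form; classically this
-- is the negation of x ≈ᴿ y.
_#_ : Rel ℝ 0ℓ
x # y = x <ᴿ y ⊎ y <ᴿ x

private
  half-pos : ∀ {ε} → 0ℚ ℚ.< ε → 0ℚ ℚ.< ½ ℚ.* ε
  half-pos = ℚₚ.*-monoʳ-<-pos ½

  halves : ∀ ε → ½ ℚ.* ε ℚ.+ ½ ℚ.* ε ≡ ε
  halves ε = begin
    ½ ℚ.* ε ℚ.+ ½ ℚ.* ε  ≡⟨ ℚₚ.*-distribʳ-+ ε ½ ½ ⟨
    1ℚ ℚ.* ε             ≡⟨ ℚₚ.*-identityˡ ε ⟩
    ε                    ∎
    where open Relation.Binary.PropositionalEquality.≡-Reasoning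

fromℚ : ℚ → ℝ
fromℚ q = mkℝ (λ _ → q) λ ε 0<ε →
  0 , λ _ _ _ _ → subst (ℚ._< ε) (sym (cong ∣_∣ (ℚₚ.+-inverseʳ q))) 0<ε

0ℝ 1ℝ : ℝ
0ℝ = fromℚ 0ℚ
1ℝ = fromℚ 1ℚ

infixl 6 _+ᴿ_
infixl 7 _*ᴿ_

_+ᴿ_ : ℝ → ℝ → ℝ
x +ᴿ y = mkℝ (λ n → seq x n ℚ.+ seq y n) λ ε 0<ε →
  let Nx , hx = cauchy x (½ ℚ.* ε) (half-pos 0<ε)
      Ny , hy = cauchy y (½ ℚ.* ε) (half-pos 0<ε)
  in Nx ℕ.⊔ Ny , λ m n N≤m N≤n →
    let open ℚₚ.≤-Reasoning
        a = seq x m ; b = seq y m ; c = seq x n ; d = seq y n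
    in begin-strict
      ∣ (a ℚ.+ b) ℚ.- (c ℚ.+ d) ∣
        ≡⟨ cong ∣_∣ (rearrange a b c d) ⟩
      ∣ (a ℚ.- c) ℚ.+ (b ℚ.- d) ∣
        ≤⟨ ℚₚ.∣p+q∣≤∣p∣+∣q∣ (a ℚ.- c) (b ℚ.- d) ⟩
      ∣ a ℚ.- c ∣ ℚ.+ ∣ b ℚ.- d ∣
        <⟨ ℚₚ.+-mono-< (hx m n (ℕₚ.m⊔n≤o⇒m≤o Nx Ny N≤m) (ℕₚ.m⊔n≤o⇒m≤o Nx Ny N≤n))
                       (hy m n (ℕₚ.m⊔n≤o⇒n≤o Nx Ny N≤m) (ℕₚ.m⊔n≤o⇒n≤o Nx Ny N≤n)) ⟩
      ½ ℚ.* ε ℚ.+ ½ ℚ.* ε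
        ≡⟨ halves ε ⟩
      ε ∎
  where
  rearrange : ∀ a b c d → (a ℚ.+ b) ℚ.- (c ℚ.+ d) ≡ (a ℚ.- c) ℚ.+ (b ℚ.- d)
  rearrange = solve 4 (λ a b c d → (a :+ b) :- (c :+ d) := (a :- c) :+ (b :- d)) refl
    where open +-*-Solver

eventually-bounded : (x : ℝ) →
  ∃[ K ] 0ℚ ℚ.< K × ∃[ N ] ∀ n → N ℕ.≤ n → ∣ seq x n ∣ ℚ.< K
eventually-bounded x =
  let N , h = cauchy x 1ℚ (ℚₚ.positive⁻¹ 1ℚ)
      a = seq x N
  in 1ℚ ℚ.+ ∣ a ∣
   , ℚₚ.+-mono-<-≤ (ℚₚ.positive⁻¹ 1ℚ) (ℚₚ.0≤∣p∣ a)
   , N , λ n N≤n →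
    let open ℚₚ.≤-Reasoning
        b = seq x n
    in begin-strict
      ∣ b ∣                      ≡⟨ cong ∣_∣ (cancel b a) ⟩
      ∣ (b ℚ.- a) ℚ.+ a ∣        ≤⟨ ℚₚ.∣p+q∣≤∣p∣+∣q∣ (b ℚ.- a) a ⟩
      ∣ b ℚ.- a ∣ ℚ.+ ∣ a ∣      <⟨ ℚₚ.+-monoˡ-< ∣ a ∣ (h n N N≤n ℕₚ.≤-refl) ⟩
      1ℚ ℚ.+ ∣ a ∣               ∎
  where
  cancel : ∀ b a → b ≡ (b ℚ.- a) ℚ.+ a
  cancel = solve 2 (λ b a → b := (b :- a) :+ a) refl
    where open +-*-Solver

_*ᴿ_ : ℝ → ℝ → ℝ
x *ᴿ y = mkℝ (λ n → seq x n ℚ.* seq y n) (proof (eventually-bounded x) (eventually-bounded y))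
  where
  split : ∀ a b c d → a ℚ.* b ℚ.- c ℚ.* d ≡ a ℚ.* (b ℚ.- d) ℚ.+ d ℚ.* (a ℚ.- c)
  split = solve 4 (λ a b c d → a :* b :- c :* d := a :* (b :- d) :+ d :* (a :- c)) refl
    where open +-*-Solver

  ∣p∣*∣q∣-bound : ∀ p q {K δ} → 0ℚ ℚ.< K → ∣ p ∣ ℚ.< K → ∣ q ∣ ℚ.< δ → ∣ p ℚ.* q ∣ ℚ.< K ℚ.* δ
  ∣p∣*∣q∣-bound p q {K} {δ} 0<K p<K q<δ = begin-strict
    ∣ p ℚ.* q ∣          ≡⟨ ℚₚ.∣p*q∣≡∣p∣*∣q∣ p q ⟩
    ∣ p ∣ ℚ.* ∣ q ∣      ≤⟨ ℚₚ.*-monoʳ-≤-nonNeg ∣ q ∣ {{ℚₚ.∣-∣-nonNeg q}} (ℚₚ.<⇒≤ p<K) ⟩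
    K ℚ.* ∣ q ∣          <⟨ ℚₚ.*-monoʳ-<-pos K {{ℚ.positive 0<K}} q<δ ⟩
    K ℚ.* δ              ∎
    where open ℚₚ.≤-Reasoning

  proof : ∃[ K ] 0ℚ ℚ.< K × (∃[ N ] ∀ n → N ℕ.≤ n → ∣ seq x n ∣ ℚ.< K) →
          ∃[ K ] 0ℚ ℚ.< K × (∃[ N ] ∀ n → N ℕ.≤ n → ∣ seq y n ∣ ℚ.< K) →
          ∀ ε → 0ℚ ℚ.< ε → ∃[ N ] ∀ m n → N ℕ.≤ m → N ℕ.≤ n →
          ∣ seq x m ℚ.* seq y m ℚ.- seq x n ℚ.* seq y n ∣ ℚ.< ε
  proof (K , 0<K , Mx , bx) (L , 0<L , My , by) ε 0<ε =
    let Nx , hx = cauchy x (δ L 0<L) (δ-pos L 0<L)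
        Ny , hy = cauchy y (δ K 0<K) (δ-pos K 0<K)
    in (Mx ℕ.⊔ My) ℕ.⊔ (Nx ℕ.⊔ Ny) , λ m n N≤m N≤n →
      let a = seq x m ; b = seq y m ; c = seq x n ; d = seq y n
          Mx≤m = ℕₚ.m⊔n≤o⇒m≤o Mx My (ℕₚ.m⊔n≤o⇒m≤o (Mx ℕ.⊔ My) (Nx ℕ.⊔ Ny) N≤m)
          My≤n = ℕₚ.m⊔n≤o⇒n≤o Mx My (ℕₚ.m⊔n≤o⇒m≤o (Mx ℕ.⊔ My) (Nx ℕ.⊔ Ny) N≤n)
          N′≤m = ℕₚ.m⊔n≤o⇒n≤o (Mx ℕ.⊔ My) (Nx ℕ.⊔ Ny) N≤m
          N′≤n = ℕₚ.m⊔n≤o⇒n≤o (Mx ℕ.⊔ My) (Nx ℕ.⊔ Ny) N≤n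
      in begin-strict
        ∣ a ℚ.* b ℚ.- c ℚ.* d ∣
          ≡⟨ cong ∣_∣ (split a b c d) ⟩
        ∣ a ℚ.* (b ℚ.- d) ℚ.+ d ℚ.* (a ℚ.- c) ∣
          ≤⟨ ℚₚ.∣p+q∣≤∣p∣+∣q∣ (a ℚ.* (b ℚ.- d)) (d ℚ.* (a ℚ.- c)) ⟩
        ∣ a ℚ.* (b ℚ.- d) ∣ ℚ.+ ∣ d ℚ.* (a ℚ.- c) ∣
          <⟨ ℚₚ.+-mono-<
               (∣p∣*∣q∣-bound a (b ℚ.- d) 0<K (bx m Mx≤m)
                 (hy m n (ℕₚ.m⊔n≤o⇒n≤o Nx Ny N′≤m) (ℕₚ.m⊔n≤o⇒n≤o Nx Ny N′≤n)))
               (∣p∣*∣q∣-bound d (a ℚ.- c) 0<L (by n My≤n)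
                 (hx m n (ℕₚ.m⊔n≤o⇒m≤o Nx Ny N′≤m) (ℕₚ.m⊔n≤o⇒m≤o Nx Ny N′≤n))) ⟩
        K ℚ.* δ K 0<K ℚ.+ L ℚ.* δ L 0<L
          ≡⟨ cong (ℚ._+ L ℚ.* δ L 0<L) (K*δ K 0<K) ⟩
        ½ ℚ.* ε ℚ.+ L ℚ.* δ L 0<L
          ≡⟨ cong (½ ℚ.* ε ℚ.+_) (K*δ L 0<L) ⟩
        ½ ℚ.* ε ℚ.+ ½ ℚ.* ε
          ≡⟨ halves ε ⟩
        ε ∎
    where
    open ℚₚ.≤-Reasoning

    inv : ∀ K → 0ℚ ℚ.< K → ℚ
    inv K 0<K = (ℚ.1/ K) {{ℚₚ.pos⇒nonZero K {{ℚ.positive 0<K}}}}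

    δ : ∀ K → 0ℚ ℚ.< K → ℚ
    δ K 0<K = inv K 0<K ℚ.* (½ ℚ.* ε)

    δ-pos : ∀ K (0<K : 0ℚ ℚ.< K) → 0ℚ ℚ.< δ K 0<K
    δ-pos K 0<K = subst (ℚ._< δ K 0<K) (ℚₚ.*-zeroʳ (inv K 0<K))
      (ℚₚ.*-monoʳ-<-pos (inv K 0<K) {{ℚₚ.1/pos⇒pos K {{ℚ.positive 0<K}}}} (half-pos 0<ε))

    K*δ : ∀ K (0<K : 0ℚ ℚ.< K) → K ℚ.* δ K 0<K ≡ ½ ℚ.* ε
    K*δ K 0<K = begin-equality
      K ℚ.* (inv K 0<K ℚ.* (½ ℚ.* ε))  ≡⟨ ℚₚ.*-assoc K (inv K 0<K) (½ ℚ.* ε) ⟨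
      K ℚ.* inv K 0<K ℚ.* (½ ℚ.* ε)    ≡⟨ cong (ℚ._* (½ ℚ.* ε))
                                             (ℚₚ.*-inverseʳ K {{ℚₚ.pos⇒nonZero K {{ℚ.positive 0<K}}}}) ⟩
      1ℚ ℚ.* (½ ℚ.* ε)                 ≡⟨ ℚₚ.*-identityˡ (½ ℚ.* ε) ⟩
      ½ ℚ.* ε                          ∎

+ᴿ-rawMonoid : RawMonoid 0ℓ 0ℓ
+ᴿ-rawMonoid = record { Carrier = ℝ ; _≈_ = _≈ᴿ_ ; _∙_ = _+ᴿ_ ; ε = 0ℝ }

open RawMonoidOps +ᴿ-rawMonoid public using (sum) renaming (_×_ to _·_)

ℝ^_ : ℕ → Set
ℝ^ m = Vector ℝ m

private
  variable
    ℓ : Level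
    m : ℕ

-- The open ε-ball in the maximum norm: |xᵢ - yᵢ| < ε for every i.
Ball : ℝ → ℝ^ m → Pred (ℝ^ m) 0ℓ
Ball ε x y = ∀ i → x i <ᴿ y i +ᴿ ε × y i <ᴿ x i +ᴿ ε

Open : Pred (ℝ^ m) 0ℓ → Set
Open S = ∀ {x} → S x → ∃[ ε ] 0ℝ <ᴿ ε × Ball ε x ⊆ S

Connected : Pred (ℝ^ m) 0ℓ → Set₁
Connected C = ∀ V W → Open V → Open W → C ⊆ V ∪ W → C ≬ V → C ≬ W →
              ¬ U.Empty (C ∩ (V ∩ W))

-- The connected component of x in S is the union of the connected subsets
-- of S that contain x.
SameComponent : Pred (ℝ^ m) 0ℓ → Rel (ℝ^ m) (suc 0ℓ)
SameComponent S x y = ∃[ C ] C ⊆ S × Connected C × C x × C y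

AffineHull : Pred (ℝ^ m) ℓ → Pred (ℝ^ m) ℓ
AffineHull {m} S y =
  ∃[ k ] Σ[ t ∈ Vector ℝ k ] Σ[ p ∈ Vector (ℝ^ m) k ]
    (∀ i → S (p i)) × sum t ≈ᴿ 1ℝ × (∀ j → y j ≈ᴿ sum (λ i → t i *ᴿ p i j))

RelativeInterior : Pred (ℝ^ m) ℓ → Pred (ℝ^ m) ℓ
RelativeInterior S x =
  S x × ∃[ ε ] 0ℝ <ᴿ ε × AffineHull S ∩ Ball ε x ⊆ S

Δ : (m : ℕ) → Pred (ℝ^ m) 0ℓ
Δ m z = (∀ i → 0ℝ ≤ᴿ z i) × sum z ≈ᴿ 1ℝ

Consecutive : Pred (Subset m) 0ℓ
Consecutive {m} S = Σ[ j ∈ Fin m ] Σ[ k ∈ Fin m ]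
  j Fin.≤ k × (∀ i → (i ∈ S) Fun.⇔ (j Fin.≤ i × i Fin.≤ k))

ProperConsecutive : Pred (Subset m) 0ℓ
ProperConsecutive S = Consecutive S × S ≢ ⊤

subsetSum : Subset m → ℝ^ m → ℝ
subsetSum S z = sum λ j → if lookup S j then z j else 0ℝ

-- The defining equations, degenerate ones included: left lists U₁, …, U_ℓ
-- and right lists U_{ℓ+1}, …, U_{h'}.
record Equation (m h : ℕ) : Set where
  field
    left right : List (Subset m)
    left-ok    : All ProperConsecutive left
    right-ok   : All ProperConsecutive right
    bound      : length left ℕ.+ length right ℕ.≤ h

  lhs rhs : ℝ^ m → ℝ
  lhs z = foldr (λ S s → subsetSum S z +ᴿ s) 0ℝ left
  rhs z = foldr (λ S s → subsetSum S z +ᴿ s) 0ℝ right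

Nondegenerate : ∀ {h} → Pred (Equation m h) 0ℓ
Nondegenerate E = ¬ (∀ z → lhs z ≈ᴿ rhs z)
  where open Equation E

Q : (m h : ℕ) → Pred (ℝ^ m) 0ℓ
Q m h z = Δ m z ×
  ((E : Equation m h) → Nondegenerate E → Equation.lhs E z # Equation.rhs E z)

SameRegion : (m h : ℕ) → Rel (ℝ^ m) (suc 0ℓ)
SameRegion m h = SameComponent (Q m h)

IsRegion : (m h : ℕ) → Pred (Pred (ℝ^ m) (suc 0ℓ)) (suc 0ℓ)
IsRegion m h R = ∃[ z ] Q m h z × R ≐ SameRegion m h z

IsOpenRegion : (m h : ℕ) → Pred (Pred (ℝ^ m) (suc 0ℓ)) (suc (suc 0ℓ))
IsOpenRegion m h O = ∃[ R ] IsRegion m h R × O ≐ RelativeInterior R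

openRegions : (m h : ℕ) → Setoid (suc (suc 0ℓ)) (suc 0ℓ)
openRegions m h = On.setoid {B = ∃ (IsOpenRegion m h)} (≐-setoid (ℝ^ m) (suc 0ℓ)) proj₁

-- p is the preceding entry (a₀ = 0 at the start); truncated subtraction is
-- exactly the case distinction defining climbⱼ.
climbFrom : ℕ → Vec ℕ m → ℕ
climbFrom p []      = 0
climbFrom p (x ∷ a) = (x ℕ.∸ p) ℕ.+ climbFrom x a

climb : Vec ℕ m → ℕ
climb = climbFrom 0

supp : Vec ℕ m → Pred (Fin m) 0ℓ
supp a i = lookup a i ≢ 0

infixl 6 _⊕_

_⊕_ : Vec ℕ m → Vec ℕ m → Vec ℕ m
_⊕_ = zipWith ℕ._+_

𝟎 : Vec ℕ m
𝟎 = replicate _ 0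

M : (h : ℕ) → Pred (Vec ℕ m) 0ℓ
M h u = climb u ℕ.≤ h

Edge : (h : ℕ) → Rel (Vec ℕ m) 0ℓ
Edge h u v = M h u × M h v × u ≢ v ×
  ∃[ a ] ∃[ b ] ∃[ c ] u ≡ a ⊕ c × v ≡ b ⊕ c ×
    U.Empty (supp a ∩ supp b) × climb a ℕ.+ climb b ℕ.≤ h

-- Membership in M h is part of Edge, so vertices are plain vectors here.
-- An orientation of all edges is given by the relation "u → v".
record IsOrientation (m h : ℕ) (_⟶_ : Rel (Vec ℕ m) 0ℓ) : Set where
  field
    edge  : ∀ {u v} → u ⟶ v → Edge h u v
    total : ∀ {u v} → Edge h u v → u ⟶ v ⊎ v ⟶ u
    asym  : ∀ {u v} → u ⟶ v → ¬ (v ⟶ u)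

record IsCoherent (m h : ℕ) (_⟶_ : Rel (Vec ℕ m) 0ℓ) : Set where
  field
    fromZero  : ∀ {u} → Edge h 𝟎 u → 𝟎 ⟶ u
    translate : ∀ {a b c} → a ≢ b → climb a ℕ.+ climb b ℕ.≤ h →
                M h (a ⊕ c) → M h (b ⊕ c) →
                ((a ⊕ c) ⟶ (b ⊕ c)) Fun.⇔ (a ⟶ b)

-- A closed directed walk of positive length contains a directed cycle, and
-- every directed cycle is such a walk.
Acyclic : ∀ {A : Set} → Pred (Rel A 0ℓ) 0ℓ
Acyclic _⟶_ = ∀ {u} → ¬ TransClosure _⟶_ u u

IsCoherentAcyclicOrientation : (m h : ℕ) → Pred (Rel (Vec ℕ m) 0ℓ) 0ℓ
IsCoherentAcyclicOrientation m h _⟶_ =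
  IsOrientation m h _⟶_ × IsCoherent m h _⟶_ × Acyclic _⟶_

⇔-setoid : Set → Setoid (suc 0ℓ) 0ℓ
⇔-setoid A = record
  { Carrier       = Rel A 0ℓ
  ; _≈_           = _⇔_
  ; isEquivalence = record
    { refl  = (λ r → r) , (λ r → r)
    ; sym   = λ (f , g) → g , f
    ; trans = λ (f , g) (f′ , g′) → (λ r → f′ (f r)) , (λ r → g (g′ r))
    }
  }

coherentAcyclicOrientations : (m h : ℕ) → Setoid (suc 0ℓ) 0ℓ
coherentAcyclicOrientations m h =
  On.setoid {B = ∃ (IsCoherentAcyclicOrientation m h)} (⇔-setoid (Vec ℕ m)) proj₁

dot : Vec ℕ m → ℝ^ m → ℝ
dot u z = sum λ i → lookup u i · z i

φ : (h : ℕ) → ℝ^ m → Rel (Vec ℕ m) 0ℓ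
φ h z u v = Edge h u v × dot u z <ᴿ dot v z

{-# OPTIONS --safe #-}
-- Write a·z for Σ aᵢ zᵢ, and call a ≠ b comparable when climb a + climb b ≤ h. The climb
-- of a is the least number of intervals whose indicators add up to a, and these are
-- proper as soon as a has a zero entry; so the hyperplanes of the arrangement are
-- a·z = b·z for comparable a, b. Subtracting the entrywise minimum makes supports
-- disjoint without increasing climb a + climb b, and if then a has full support, b = 0
-- and a·z > 0 on Q. Hence a·z ≠ b·z on Q for all comparable pairs, which are, up to
-- translation, the edges of Γ, and φ(z) records exactly the signs of these differences.
-- The sets {u·z < v·z} are open, so the signs are constant on connected subsets of Q;
-- conversely the points of Q with given signs form a convex, hence connected, set, which
-- is open relative to Σ zᵢ = 1 because only finitely many pairs are comparable.
module Submission where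

open import Defs
open import Algebra.Bundles using (CommutativeRing)
import Algebra.Properties.CommutativeMonoid.Mult as CommutativeMonoidMult
import Algebra.Properties.Semiring.Sum as SemiringSum
open import Data.Bool.Base using (if_then_else_)
open import Data.Fin.Base as Fin using (Fin; zero; suc)
open import Data.Fin.Properties using (any?)
open import Data.Fin.Subset using (Subset; inside; outside; ⊤; ⊥; _∈_)
open import Data.Fin.Subset.Properties using (∉⊥; drop-there)
import Data.Integer.Base as ℤ
import Data.Integer.Properties as ℤₚ
open import Data.List.Base as List using (List; []; _∷_; _++_; length; take; drop)
import Data.List.Properties as Listₚ
open import Data.List.Relation.Unary.All as All using (All; []; _∷_)
import Data.List.Relation.Unary.All.Properties as Allₚ
open import Data.Nat.Base as ℕ using (ℕ; zero; suc; _≤_; _+_; _∸_; _⊓_; z≤n; s≤s)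
import Data.Nat.Coprimality as Coprime
import Data.Nat.Properties as ℕₚ
open import Data.Product using (Σ-syntax; ∃; ∃-syntax; _×_; _,_; proj₁; proj₂)
open import Data.Rational.Base as ℚ using (ℚ; 0ℚ; 1ℚ; ½; ∣_∣; mkℚ)
import Data.Rational.Properties as ℚₚ
open import Data.Rational.Solver using (module +-*-Solver)
import Data.Rational.Unnormalised.Base as ℚᵘ
import Data.Rational.Unnormalised.Properties as ℚᵘₚ
open import Data.Sum.Base as Sum using (_⊎_; inj₁; inj₂)
open import Data.Vec.Base as Vec using (Vec; []; _∷_; lookup; zipWith)
open import Data.Vec.Functional using (Vector)
import Data.Vec.Properties as Vecₚ
open import Function.Base using (_∘_)
open import Function.Bundles using (Equivalence; Injection; mk⇔) renaming (_⇔_ to _⟷_)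
open import Level using (0ℓ) renaming (suc to lsuc)
open import Relation.Binary.Construct.Closure.Transitive using (TransClosure; [_]; _∷_)
open import Relation.Binary.Core using (_⇔_)
open import Relation.Binary.Definitions using (tri<; tri≈; tri>)
open import Relation.Binary.PropositionalEquality
open import Relation.Nullary using (Dec; ¬_; yes; no; contradiction)
open import Relation.Nullary.Decidable using (_×-dec_; ¬?)
open import Relation.Unary as U using (Pred; _∩_; _⊆_; Empty)
open import Relation.Unary.Properties using (≐-sym; ≐-trans)

open import Algebra.Properties.CommutativeSemigroup ℕₚ.+-commutativeSemigroup using (interchange; xy∙z≈xz∙y)
open SemiringSum (CommutativeRing.semiring ℚₚ.+-*-commutativeRing)
  using (sum-cong-≗; ∑-distrib-+; ∑-comm; *-distribˡ-sum) renaming (sum to sumℚ)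
open CommutativeMonoidMult ℚₚ.+-0-commutativeMonoid
  using (×-distrib-+; ×-homo-+) renaming (_×_ to _×ℚ_)
open +-*-Solver using (solve; _:=_; _:+_; _:*_; _:-_; :-_; con)

-- Reals are Cauchy sequences, whose order is not decidable, so no sign may be tested. None has to
-- be: membership in `Q` asserts `_#_` for each hyperplane and thereby says which side holds, and a
-- cover by two open sets says at each point which of the two contains it. The usual supremum
-- argument for the connectedness of a segment is therefore replaced by a bisection over rational
-- parameters. Sums and products of reals act term by term, so a claim about real linear forms
-- reduces to rational inequalities at single large indices. Relative openness of regions matters
-- because open regions are given only as relative interiors: it puts the chosen point of a region
-- into its open region, so that equal open regions have equal orientations.

private variable
  m n : ℕ

-- Vectors of natural numbers and their climb

⊕-assoc : (a b c : Vec ℕ m) → (a ⊕ b) ⊕ c ≡ a ⊕ (b ⊕ c)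
⊕-assoc = Vecₚ.zipWith-assoc ℕₚ.+-assoc

⊕-identityˡ : (a : Vec ℕ m) → 𝟎 ⊕ a ≡ a
⊕-identityˡ = Vecₚ.zipWith-identityˡ ℕₚ.+-identityˡ

⊕-identityʳ : (a : Vec ℕ m) → a ⊕ 𝟎 ≡ a
⊕-identityʳ = Vecₚ.zipWith-identityʳ ℕₚ.+-identityʳ

⊕-cancelʳ : (c : Vec ℕ m) {a b : Vec ℕ m} → a ⊕ c ≡ b ⊕ c → a ≡ b
⊕-cancelʳ [] {[]} {[]} _ = refl
⊕-cancelʳ (z ∷ c) {x ∷ a} {y ∷ b} eq =
  cong₂ _∷_ (ℕₚ.+-cancelʳ-≡ z x y (Vecₚ.∷-injectiveˡ eq)) (⊕-cancelʳ c (Vecₚ.∷-injectiveʳ eq))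

∸-subadditive : ∀ x y p q → (x + y) ∸ (p + q) ≤ (x ∸ p) + (y ∸ q)
∸-subadditive x y p q = ℕₚ.m≤n+o⇒m∸n≤o (x + y) (p + q) (begin
  x + y                          ≤⟨ ℕₚ.+-mono-≤ (ℕₚ.m≤n+m∸n x p) (ℕₚ.m≤n+m∸n y q) ⟩
  (p + (x ∸ p)) + (q + (y ∸ q))  ≡⟨ interchange p (x ∸ p) q (y ∸ q) ⟩
  (p + q) + ((x ∸ p) + (y ∸ q))  ∎)
  where open ℕₚ.≤-Reasoning

climbFrom-⊕ : ∀ p q (a b : Vec ℕ m) → climbFrom (p + q) (a ⊕ b) ≤ climbFrom p a + climbFrom q b
climbFrom-⊕ p q []      []      = z≤n
climbFrom-⊕ p q (x ∷ a) (y ∷ b) = begin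
  ((x + y) ∸ (p + q)) + climbFrom (x + y) (a ⊕ b)
    ≤⟨ ℕₚ.+-mono-≤ (∸-subadditive x y p q) (climbFrom-⊕ x y a b) ⟩
  ((x ∸ p) + (y ∸ q)) + (climbFrom x a + climbFrom y b)
    ≡⟨ interchange (x ∸ p) (y ∸ q) (climbFrom x a) (climbFrom y b) ⟩
  ((x ∸ p) + climbFrom x a) + ((y ∸ q) + climbFrom y b) ∎
  where open ℕₚ.≤-Reasoning

climb-𝟎 : ∀ m p → climbFrom p (𝟎 {m}) ≡ 0
climb-𝟎 zero    p = refl
climb-𝟎 (suc m) p = cong₂ _+_ (ℕₚ.0∸n≡0 p) (climb-𝟎 m 0)

-- Reaching height `lookup a i` from height `p` costs at least the difference in climb. This
-- confines comparable vectors to a finite box.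
lookup≤climbFrom : ∀ p (a : Vec ℕ m) i → lookup a i ≤ p + climbFrom p a
lookup≤climbFrom p (x ∷ a) i = ℕₚ.≤-trans (go i) (begin
    x + climbFrom x a              ≤⟨ ℕₚ.+-monoˡ-≤ _ (ℕₚ.m≤n+m∸n x p) ⟩
    (p + (x ∸ p)) + climbFrom x a  ≡⟨ ℕₚ.+-assoc p (x ∸ p) _ ⟩
    p + ((x ∸ p) + climbFrom x a)  ∎)
  where
  open ℕₚ.≤-Reasoning
  go : ∀ i → lookup (x ∷ a) i ≤ x + climbFrom x a
  go zero    = ℕₚ.m≤m+n x _
  go (suc i) = lookup≤climbFrom x a i

infixl 6 _⊖_

-- `a ⊖ b` and `b ⊖ a` are the positive and the negative part of a - b.
_⊖_ : Vec ℕ m → Vec ℕ m → Vec ℕ m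
_⊖_ = zipWith _∸_

_⊓⃗_ : Vec ℕ m → Vec ℕ m → Vec ℕ m
_⊓⃗_ = zipWith _⊓_

⊖-⊓ : (a b : Vec ℕ m) → a ≡ (a ⊖ b) ⊕ (a ⊓⃗ b)
⊖-⊓ []      []      = refl
⊖-⊓ (x ∷ a) (y ∷ b) = cong₂ _∷_ (begin
  x                  ≡⟨ ℕₚ.m⊓n+n∸m≡n y x ⟨
  (y ⊓ x) + (x ∸ y)  ≡⟨ ℕₚ.+-comm (y ⊓ x) (x ∸ y) ⟩
  (x ∸ y) + (y ⊓ x)  ≡⟨ cong ((x ∸ y) +_) (ℕₚ.⊓-comm y x) ⟩
  (x ∸ y) + (x ⊓ y)  ∎) (⊖-⊓ a b)
  where open ≡-Reasoning

⊓-comm⃗ : (a b : Vec ℕ m) → a ⊓⃗ b ≡ b ⊓⃗ a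
⊓-comm⃗ = Vecₚ.zipWith-comm ℕₚ.⊓-comm

⊖-disjoint : (a b : Vec ℕ m) → Empty (supp (a ⊖ b) ∩ supp (b ⊖ a))
⊖-disjoint a b i (p , q) rewrite Vecₚ.lookup-zipWith _∸_ i a b | Vecₚ.lookup-zipWith _∸_ i b a
  with ℕₚ.≤-total (lookup a i) (lookup b i)
... | inj₁ a≤b = p (ℕₚ.m≤n⇒m∸n≡0 a≤b)
... | inj₂ b≤a = q (ℕₚ.m≤n⇒m∸n≡0 b≤a)

∸-reduce-≤ : ∀ x y p q → y ≤ x → ((x ∸ y) ∸ (p ∸ q)) + y ≤ (x ∸ p) + (y ∸ q) + (p ⊓ q)
∸-reduce-≤ x y p q y≤x with ℕₚ.≤-total p q
... | inj₁ p≤q rewrite ℕₚ.m≤n⇒m∸n≡0 p≤q | ℕₚ.m≤n⇒m⊓n≡m p≤q | ℕₚ.m∸n+n≡m y≤x = begin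
  x                      ≤⟨ ℕₚ.m≤n+m∸n x p ⟩
  p + (x ∸ p)            ≡⟨ ℕₚ.+-comm p (x ∸ p) ⟩
  (x ∸ p) + p            ≤⟨ ℕₚ.+-monoˡ-≤ p (ℕₚ.m≤m+n (x ∸ p) (y ∸ q)) ⟩
  (x ∸ p) + (y ∸ q) + p  ∎
  where open ℕₚ.≤-Reasoning
... | inj₂ q≤p rewrite ℕₚ.m≥n⇒m⊓n≡n q≤p with ℕₚ.≤-total (x ∸ y) (p ∸ q)
...   | inj₁ d≤e rewrite ℕₚ.m≤n⇒m∸n≡0 d≤e = begin
  y                      ≤⟨ ℕₚ.m≤n+m∸n y q ⟩
  q + (y ∸ q)            ≡⟨ ℕₚ.+-comm q (y ∸ q) ⟩
  (y ∸ q) + q            ≤⟨ ℕₚ.+-monoˡ-≤ q (ℕₚ.m≤n+m (y ∸ q) (x ∸ p)) ⟩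
  (x ∸ p) + (y ∸ q) + q  ∎
  where open ℕₚ.≤-Reasoning
-- Adding `p ∸ q` to both sides undoes the outer truncation, which is exact in this case.
...   | inj₂ e≤d = ℕₚ.+-cancelʳ-≤ (p ∸ q) _ _ (begin
  (d∸e + y) + (p ∸ q)              ≡⟨ xy∙z≈xz∙y d∸e y (p ∸ q) ⟩
  (d∸e + (p ∸ q)) + y              ≡⟨ cong (_+ y) (ℕₚ.m∸n+n≡m e≤d) ⟩
  (x ∸ y) + y                      ≡⟨ ℕₚ.m∸n+n≡m y≤x ⟩
  x                                ≤⟨ ℕₚ.m≤n+m∸n x p ⟩
  p + (x ∸ p)                      ≡⟨ ℕₚ.+-comm p (x ∸ p) ⟩
  (x ∸ p) + p                      ≡⟨ cong ((x ∸ p) +_) (ℕₚ.m+[n∸m]≡n q≤p) ⟨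
  (x ∸ p) + (q + (p ∸ q))          ≡⟨ ℕₚ.+-assoc (x ∸ p) q _ ⟨
  (x ∸ p) + q + (p ∸ q)            ≤⟨ ℕₚ.+-monoˡ-≤ (p ∸ q) (ℕₚ.+-monoˡ-≤ q (ℕₚ.m≤m+n (x ∸ p) (y ∸ q))) ⟩
  (x ∸ p) + (y ∸ q) + q + (p ∸ q)  ∎)
  where
  open ℕₚ.≤-Reasoning
  d∸e = (x ∸ y) ∸ (p ∸ q)

-- An increase t ∸ s is half of |t - s| + (t - s). With the minima also written by absolute values,
-- what remains after cancelling is the triangle inequality |(x - p) - (y - q)| ≤ |x - p| + |y - q|,
-- checked here by cases.
∸-reduce : ∀ x y p q →
  ((x ∸ y) ∸ (p ∸ q)) + ((y ∸ x) ∸ (q ∸ p)) + (x ⊓ y) ≤ (x ∸ p) + (y ∸ q) + (p ⊓ q)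
∸-reduce x y p q with ℕₚ.≤-total y x
... | inj₁ y≤x rewrite ℕₚ.m≤n⇒m∸n≡0 y≤x | ℕₚ.0∸n≡0 (q ∸ p) | ℕₚ.m≥n⇒m⊓n≡n y≤x
                     | ℕₚ.+-identityʳ ((x ∸ y) ∸ (p ∸ q)) = ∸-reduce-≤ x y p q y≤x
... | inj₂ x≤y rewrite ℕₚ.m≤n⇒m∸n≡0 x≤y | ℕₚ.0∸n≡0 (p ∸ q) | ℕₚ.m≤n⇒m⊓n≡m x≤y
                     | ℕₚ.+-comm (x ∸ p) (y ∸ q) | ℕₚ.⊓-comm p q = ∸-reduce-≤ y x q p x≤y

-- 2 climbFrom p a + p is the total variation of the sequence p, a, 0, and the variation
-- of a − b is both at most that of a plus that of b and split between a ⊖ b and b ⊖ a.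
climbFrom-⊖ : ∀ p q (a b : Vec ℕ m) →
  climbFrom (p ∸ q) (a ⊖ b) + climbFrom (q ∸ p) (b ⊖ a) ≤ climbFrom p a + climbFrom q b + (p ⊓ q)
climbFrom-⊖ p q []      []      = z≤n
climbFrom-⊖ p q (x ∷ a) (y ∷ b) = begin
  (d + climbFrom (x ∸ y) (a ⊖ b)) + (e + climbFrom (y ∸ x) (b ⊖ a))
    ≡⟨ interchange d _ e _ ⟩
  (d + e) + (climbFrom (x ∸ y) (a ⊖ b) + climbFrom (y ∸ x) (b ⊖ a))
    ≤⟨ ℕₚ.+-monoʳ-≤ (d + e) (climbFrom-⊖ x y a b) ⟩
  (d + e) + ((A + B) + (x ⊓ y))
    ≡⟨ cong ((d + e) +_) (ℕₚ.+-comm (A + B) (x ⊓ y)) ⟩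
  (d + e) + ((x ⊓ y) + (A + B))
    ≡⟨ ℕₚ.+-assoc (d + e) (x ⊓ y) (A + B) ⟨
  (d + e) + (x ⊓ y) + (A + B)
    ≤⟨ ℕₚ.+-monoˡ-≤ (A + B) (∸-reduce x y p q) ⟩
  (x ∸ p) + (y ∸ q) + (p ⊓ q) + (A + B)
    ≡⟨ xy∙z≈xz∙y ((x ∸ p) + (y ∸ q)) (p ⊓ q) (A + B) ⟩
  (x ∸ p) + (y ∸ q) + (A + B) + (p ⊓ q)
    ≡⟨ cong (_+ (p ⊓ q)) (interchange (x ∸ p) (y ∸ q) A B) ⟩
  ((x ∸ p) + A) + ((y ∸ q) + B) + (p ⊓ q) ∎
  where
  open ℕₚ.≤-Reasoning
  d = (x ∸ y) ∸ (p ∸ q)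
  e = (y ∸ x) ∸ (q ∸ p)
  A = climbFrom x a
  B = climbFrom y b

climb-⊖ : (a b : Vec ℕ m) → climb (a ⊖ b) + climb (b ⊖ a) ≤ climb a + climb b
climb-⊖ a b = subst (climb (a ⊖ b) + climb (b ⊖ a) ≤_) (ℕₚ.+-identityʳ _) (climbFrom-⊖ 0 0 a b)

-- Indicator vectors and sums of intervals

ind : Subset m → Vec ℕ m
ind = Vec.map (λ s → if s then 1 else 0)

-- The multiplicity with which the sets of the list cover each coordinate, that is, the coefficient
-- vector of one side of an equation.
coef : List (Subset m) → Vec ℕ m
coef = List.foldr (λ S v → ind S ⊕ v) 𝟎

ind-⊥ : ∀ m → ind (⊥ {m}) ≡ 𝟎
ind-⊥ m = Vecₚ.map-replicate _ outside m

coef-++ : (L L′ : List (Subset m)) → coef (L ++ L′) ≡ coef L ⊕ coef L′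
coef-++ []      L′ = sym (⊕-identityˡ (coef L′))
coef-++ (S ∷ L) L′ = trans (cong (ind S ⊕_) (coef-++ L L′)) (sym (⊕-assoc (ind S) (coef L) (coef L′)))

coef-inside : (L : List (Subset m)) → coef (List.map (inside ∷_) L) ≡ length L ∷ coef L
coef-inside []      = refl
coef-inside (S ∷ L) = cong (ind (inside ∷ S) ⊕_) (coef-inside L)

coef-outside : (L : List (Subset m)) → coef (List.map (outside ∷_) L) ≡ 0 ∷ coef L
coef-outside []      = refl
coef-outside (S ∷ L) = cong (ind (outside ∷ S) ⊕_) (coef-outside L)

coef-⊥ : ∀ k → coef (List.replicate k (⊥ {m})) ≡ 𝟎
coef-⊥ zero        = refl
coef-⊥ {m} (suc k) = trans (cong₂ _⊕_ (ind-⊥ m) (coef-⊥ k)) (⊕-identityˡ 𝟎)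

-- Possibly empty, unlike a consecutive subset.
data Initial : Subset m → Set where
  none : Initial (⊥ {m})
  more : {S : Subset m} → Initial S → Initial (inside ∷ S)

-- With `inside` in front the set is never empty, so it has a last element even when `S` is empty.
initial-max : {S : Subset m} → Initial S →
  Σ[ k ∈ Fin (suc m) ] ∀ i → (i ∈ inside ∷ S) ⟷ (i Fin.≤ k)
initial-max none = zero , λ
  { zero    → mk⇔ (λ _ → z≤n) (λ _ → Vec.here)
  ; (suc i) → mk⇔ (λ { (Vec.there i∈⊥) → contradiction i∈⊥ ∉⊥ }) (λ ())
  }
initial-max (more I) with k , f ← initial-max I = suc k , λ
  { zero    → mk⇔ (λ _ → z≤n) (λ _ → Vec.here)
  ; (suc i) → mk⇔ (λ { (Vec.there i∈S) → s≤s (Equivalence.to (f i) i∈S) })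
                  (λ { (s≤s i≤k) → Vec.there (Equivalence.from (f i) i≤k) })
  }

consecutive-inside : {S : Subset m} → Initial S → Consecutive (inside ∷ S)
consecutive-inside I with k , f ← initial-max I =
  zero , k , z≤n , λ i → mk⇔ (λ i∈ → z≤n , Equivalence.to (f i) i∈) (Equivalence.from (f i) ∘ proj₂)

consecutive-outside : {S : Subset m} → Consecutive S → Consecutive (outside ∷ S)
consecutive-outside (j , k , j≤k , f) = suc j , suc k , s≤s j≤k , λ
  { zero    → mk⇔ (λ ()) (λ ())
  ; (suc i) → mk⇔ (λ { (Vec.there i∈S) → let a , b = Equivalence.to (f i) i∈S in s≤s a , s≤s b })
                  (λ { (s≤s a , s≤s b) → Vec.there (Equivalence.from (f i) (a , b)) })
  }

-- Scanning a vector whose preceding entry is p, p of the intervals are still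
-- open (their remaining parts may be empty) and each unit of climb starts a new one.
decompose : ∀ p (a : Vec ℕ m) → Σ[ U ∈ List (Subset m) ] Σ[ C ∈ List (Subset m) ]
  All Initial U × length U ≡ p × All Consecutive C × length C ≡ climbFrom p a × coef U ⊕ coef C ≡ a
decompose p [] = List.replicate p [] , [] , Allₚ.replicate⁺ p none , Listₚ.length-replicate p , [] , refl , empty _
  where
  empty : (v : Vec ℕ 0) → v ≡ []
  empty [] = refl
decompose p (x ∷ a) with U , C , U-init , refl , C-cons , |C| , eq ← decompose x a =
    -- The recursive call returns as many open intervals as the current entry. The first `p` of them
    -- continue earlier ones and the rest start here; if there are fewer than `p`, the missing ones
    -- have ended and are padded with `⊥`.
    take p V ++ List.replicate (p ∸ length U) ⊥ , drop p V ++ List.map (outside ∷_) C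
  , Allₚ.++⁺ (Allₚ.take⁺ p (Allₚ.map⁺ (All.map more U-init))) (Allₚ.replicate⁺ (p ∸ length U) none)
  , |U′|
  , Allₚ.++⁺ (Allₚ.drop⁺ p (Allₚ.map⁺ (All.map consecutive-inside U-init))) (Allₚ.map⁺ (All.map consecutive-outside C-cons))
  , |C′|
  , coef-eq
  where
  V = List.map (inside ∷_) U
  |V| : length V ≡ length U
  |V| = Listₚ.length-map (inside ∷_) U
  |U′| : length (take p V ++ List.replicate (p ∸ length U) ⊥) ≡ p
  |U′| = begin
    length (take p V ++ List.replicate (p ∸ length U) ⊥)
      ≡⟨ Listₚ.length-++ (take p V) ⟩
    length (take p V) + length (List.replicate (p ∸ length U) ⊥)
      ≡⟨ cong₂ _+_ (trans (Listₚ.length-take p V) (cong (p ⊓_) |V|)) (Listₚ.length-replicate (p ∸ length U)) ⟩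
    p ⊓ length U + (p ∸ length U)
      ≡⟨ trans (cong (_+ (p ∸ length U)) (ℕₚ.⊓-comm p (length U))) (ℕₚ.m⊓n+n∸m≡n (length U) p) ⟩
    p ∎
    where open ≡-Reasoning
  |C′| : length (drop p V ++ List.map (outside ∷_) C) ≡ (length U ∸ p) + climbFrom (length U) a
  |C′| = trans (Listₚ.length-++ (drop p V))
    (cong₂ _+_ (trans (Listₚ.length-drop p V) (cong (_∸ p) |V|)) (trans (Listₚ.length-map (outside ∷_) C) |C|))
  coef-eq : coef (take p V ++ List.replicate (p ∸ length U) ⊥) ⊕ coef (drop p V ++ List.map (outside ∷_) C) ≡ length U ∷ a
  coef-eq = begin
    coef (take p V ++ R) ⊕ coef (drop p V ++ W)
      ≡⟨ cong₂ _⊕_ (trans (coef-++ (take p V) R) (trans (cong (coef (take p V) ⊕_) (coef-⊥ (p ∸ length U))) (⊕-identityʳ _)))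
                   (coef-++ (drop p V) W) ⟩
    coef (take p V) ⊕ (coef (drop p V) ⊕ coef W)
      ≡⟨ ⊕-assoc (coef (take p V)) _ _ ⟨
    (coef (take p V) ⊕ coef (drop p V)) ⊕ coef W
      ≡⟨ cong (_⊕ coef W) (coef-++ (take p V) (drop p V)) ⟨
    coef (take p V ++ drop p V) ⊕ coef W
      ≡⟨ cong₂ (λ L v → coef L ⊕ v) (Listₚ.take++drop≡id p V) (coef-outside C) ⟩
    coef V ⊕ (0 ∷ coef C)
      ≡⟨ cong (_⊕ (0 ∷ coef C)) (coef-inside U) ⟩
    (length U + 0) ∷ (coef U ⊕ coef C)
      ≡⟨ cong₂ _∷_ (ℕₚ.+-identityʳ _) eq ⟩
    length U ∷ a ∎
    where
    open ≡-Reasoning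
    R = List.replicate (p ∸ length U) ⊥
    W = List.map (outside ∷_) C

-- A copy of `⊤` in the list would contribute 1 to every coordinate.
coef-zero : (L : List (Subset m)) {i : Fin m} → lookup (coef L) i ≡ 0 → All (λ S → S ≢ ⊤) L
coef-zero []      eq = []
coef-zero {m} (S ∷ L) {i} eq = S≢⊤ ∷ coef-zero L (ℕₚ.m+n≡0⇒n≡0 (lookup (ind S) i) eq′)
  where
  eq′ : lookup (ind S) i + lookup (coef L) i ≡ 0
  eq′ = trans (sym (Vecₚ.lookup-zipWith _+_ i (ind S) (coef L))) eq
  S≢⊤ : S ≢ ⊤
  S≢⊤ refl = ℕₚ.0≢1+n (begin
    0                    ≡⟨ ℕₚ.m+n≡0⇒m≡0 (lookup (ind S) i) eq′ ⟨
    lookup (ind S) i     ≡⟨ Vecₚ.lookup-map i _ S ⟩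
    (if lookup S i then 1 else 0)  ≡⟨ cong (if_then 1 else 0) (Vecₚ.lookup-replicate i inside) ⟩
    1                    ∎)
    where open ≡-Reasoning

decompose-proper : (a : Vec ℕ m) {i : Fin m} → lookup a i ≡ 0 →
  Σ[ L ∈ List (Subset m) ] All ProperConsecutive L × length L ≡ climb a × coef L ≡ a
decompose-proper a {i} aᵢ≡0 with decompose 0 a
... | [] , C , _ , refl , C-cons , |C| , eq =
  C , All.zip (C-cons , coef-zero C (trans (cong (λ v → lookup v i) coef≡a) aᵢ≡0)) , |C| , coef≡a
  where
  coef≡a : coef C ≡ a
  coef≡a = trans (sym (⊕-identityˡ (coef C))) eq

climb-empty : (S : Subset m) → (∀ i → ¬ i ∈ S) → ∀ p → climbFrom p (ind S) ≡ 0
climb-empty []            _ p = refl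
climb-empty (inside  ∷ S) f p = contradiction Vec.here (f zero)
climb-empty (outside ∷ S) f p = cong₂ _+_ (ℕₚ.0∸n≡0 p) (climb-empty S (λ i → f (suc i) ∘ Vec.there) 0)

climb-downClosed : (S : Subset m) → (∀ i j → i Fin.≤ j → j ∈ S → i ∈ S) → climbFrom 1 (ind S) ≡ 0
climb-downClosed []            _ = refl
climb-downClosed (inside  ∷ S) f = climb-downClosed S λ i j i≤j j∈S → drop-there (f (suc i) (suc j) (s≤s i≤j) (Vec.there j∈S))
climb-downClosed (outside ∷ S) f = climb-empty S (λ i i∈S → zero∉outside (f zero (suc i) z≤n (Vec.there i∈S))) 0
  where
  zero∉outside : ¬ zero ∈ outside ∷ S
  zero∉outside ()

-- Convexity is used in place of two end points because it passes to tails unchanged. Once the set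
-- has started, its tail is an initial segment preceded by the entry 1, so it climbs no further.
climb-convex : (S : Subset m) → (∀ i j k → i Fin.≤ j → j Fin.≤ k → i ∈ S → k ∈ S → j ∈ S) → climb (ind S) ≤ 1
climb-convex []            _ = z≤n
climb-convex (outside ∷ S) f = climb-convex S λ i j k i≤j j≤k i∈S k∈S →
  drop-there (f (suc i) (suc j) (suc k) (s≤s i≤j) (s≤s j≤k) (Vec.there i∈S) (Vec.there k∈S))
climb-convex (inside ∷ S) f = s≤s (ℕₚ.≤-reflexive (climb-downClosed S λ i j i≤j j∈S →
  drop-there (f zero (suc i) (suc j) z≤n (s≤s i≤j) Vec.here (Vec.there j∈S))))

-- Each interval contributes at most 1, by `climb-convex` and subadditivity. As a converse to
-- `decompose-proper`, this makes the two sides of every nondegenerate equation a comparable pair.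
climb-coef : (L : List (Subset m)) → All ProperConsecutive L → climb (coef L) ≤ length L
climb-coef {m} []      _        = ℕₚ.≤-reflexive (climb-𝟎 m 0)
climb-coef (S ∷ L) (((j , k , _ , f) , _) ∷ rest) = ℕₚ.≤-trans (climbFrom-⊕ 0 0 (ind S) (coef L))
  (ℕₚ.+-mono-≤ (climb-convex S λ i i′ i″ i≤i′ i′≤i″ i∈S i″∈S →
      Equivalence.from (f i′) ( ℕₚ.≤-trans (proj₁ (Equivalence.to (f i) i∈S)) i≤i′
                              , ℕₚ.≤-trans i′≤i″ (proj₂ (Equivalence.to (f i″) i″∈S))))
    (climb-coef L rest))

unit : Fin m → Vec ℕ m
unit zero    = 1 ∷ 𝟎
unit (suc i) = 0 ∷ unit i

climb-unit : (i : Fin m) → climb (unit i) ≡ 1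
climb-unit {suc m} zero    = cong suc (climb-𝟎 m 1)
climb-unit (suc i) = climb-unit i

unit≢𝟎 : (i : Fin m) → 𝟎 ≢ unit i
unit≢𝟎 zero    ()
unit≢𝟎 (suc i) eq = unit≢𝟎 i (Vecₚ.∷-injectiveʳ eq)

-- Rational inequalities

-- Reduces a linear rearrangement of an inequality to a ring identity between the differences of the
-- two sides, which the solver can check.
ℚ-shift-≤ : ∀ {p q} p′ q′ → q ℚ.- p ≡ q′ ℚ.- p′ → p ℚ.≤ q → p′ ℚ.≤ q′
ℚ-shift-≤ {p} {q} p′ q′ eq p≤q = subst₂ ℚ._≤_
  (solve 2 (λ p p′ → p :+ (p′ :- p) := p′) refl p p′)
  (trans (solve 3 (λ p q p′ → q :+ (p′ :- p) := (q :- p) :+ p′) refl p q p′)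
    (trans (cong (ℚ._+ p′) eq) (solve 2 (λ p′ q′ → (q′ :- p′) :+ p′ := q′) refl p′ q′)))
  (ℚₚ.+-monoˡ-≤ (p′ ℚ.- p) p≤q)

½-pos : ∀ {ε} → 0ℚ ℚ.< ε → 0ℚ ℚ.< ½ ℚ.* ε
½-pos = ℚₚ.*-monoʳ-<-pos ½

½+½ : ∀ ε → ½ ℚ.* ε ℚ.+ ½ ℚ.* ε ≡ ε
½+½ ε = trans (sym (ℚₚ.*-distribʳ-+ ε ½ ½)) (ℚₚ.*-identityˡ ε)

½-< : ∀ {ε} → 0ℚ ℚ.< ε → ½ ℚ.* ε ℚ.< ε
½-< {ε} 0<ε = subst₂ ℚ._<_ (ℚₚ.+-identityˡ _) (½+½ ε) (ℚₚ.+-monoˡ-< (½ ℚ.* ε) (½-pos 0<ε))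

0≤1 : 0ℚ ℚ.≤ 1ℚ
0≤1 = ℚₚ.nonNegative⁻¹ 1ℚ

*-mono-≤-nonNeg : ∀ {r p q} → 0ℚ ℚ.≤ r → p ℚ.≤ q → r ℚ.* p ℚ.≤ r ℚ.* q
*-mono-≤-nonNeg {r} 0≤r = ℚₚ.*-monoˡ-≤-nonNeg r {{ℚ.nonNegative 0≤r}}

p<p+ε : ∀ p {ε} → 0ℚ ℚ.< ε → p ℚ.< p ℚ.+ ε
p<p+ε p {ε} 0<ε = subst (ℚ._< p ℚ.+ ε) (ℚₚ.+-identityʳ p) (ℚₚ.+-monoʳ-< p 0<ε)

-- The witness is δ / (K + 1); adding 1 keeps the divisor positive when K = 0.
∃-small-multiple : ∀ {K δ} → 0ℚ ℚ.≤ K → 0ℚ ℚ.< δ → ∃[ e ] 0ℚ ℚ.< e × K ℚ.* e ℚ.≤ δ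
∃-small-multiple {K} {δ} 0≤K 0<δ = e , 0<e , (begin
  K ℚ.* e              ≤⟨ ℚₚ.*-monoʳ-≤-nonNeg e {{ℚ.nonNegative (ℚₚ.<⇒≤ 0<e)}} (ℚₚ.<⇒≤ (p<p+ε K (ℚₚ.positive⁻¹ 1ℚ))) ⟩
  K+1 ℚ.* e            ≡⟨ ℚₚ.*-assoc K+1 inv δ ⟨
  K+1 ℚ.* inv ℚ.* δ    ≡⟨ cong (ℚ._* δ) (ℚₚ.*-inverseʳ K+1) ⟩
  1ℚ ℚ.* δ             ≡⟨ ℚₚ.*-identityˡ δ ⟩
  δ                    ∎)
  where
  open ℚₚ.≤-Reasoning
  K+1 = K ℚ.+ 1ℚ
  0<K+1 : 0ℚ ℚ.< K+1
  0<K+1 = ℚₚ.+-mono-≤-< 0≤K (ℚₚ.positive⁻¹ 1ℚ)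
  instance
    K+1-pos : ℚ.Positive K+1
    K+1-pos = ℚ.positive 0<K+1
    K+1-nonZero : ℚ.NonZero K+1
    K+1-nonZero = ℚₚ.pos⇒nonZero K+1
  inv = ℚ.1/ K+1
  e = inv ℚ.* δ
  0<e : 0ℚ ℚ.< e
  0<e = subst (ℚ._< e) (ℚₚ.*-zeroʳ inv) (ℚₚ.*-monoʳ-<-pos inv {{ℚₚ.1/pos⇒pos K+1}} 0<δ)

p≤∣p∣ : ∀ p → p ℚ.≤ ∣ p ∣
p≤∣p∣ p with ℚₚ.≤-total 0ℚ p
... | inj₁ 0≤p = ℚₚ.≤-reflexive (sym (ℚₚ.0≤p⇒∣p∣≡p 0≤p))
... | inj₂ p≤0 = ℚₚ.≤-trans p≤0 (ℚₚ.0≤∣p∣ p)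

-- Kept as two inequalities because monotone forms transport each of them separately.
Close : ℚ → ℚ → ℚ → Set
Close e p q = p ℚ.≤ q ℚ.+ e × q ℚ.≤ p ℚ.+ e

Close⇒∣-∣≤ : ∀ {e} p q → Close e p q → ∣ p ℚ.- q ∣ ℚ.≤ e
Close⇒∣-∣≤ {e} p q (p≤ , q≤) with ℚₚ.∣p∣≡p∨∣p∣≡-p (p ℚ.- q)
... | inj₁ eq = subst (ℚ._≤ e) (sym eq)
  (ℚ-shift-≤ _ _ (solve 3 (λ p q e → (q :+ e) :- p := e :- (p :- q)) refl p q e) p≤)
... | inj₂ eq = subst (ℚ._≤ e) (sym eq)
  (ℚ-shift-≤ _ _ (solve 3 (λ p q e → (p :+ e) :- q := e :- (:- (p :- q))) refl p q e) q≤)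

∣-∣≤⇒Close : ∀ {e} p q → ∣ p ℚ.- q ∣ ℚ.≤ e → Close e p q
∣-∣≤⇒Close {e} p q d≤e =
    ℚ-shift-≤ _ _ (solve 3 (λ p q e → e :- (p :- q) := (q :+ e) :- p) refl p q e)
      (ℚₚ.≤-trans (p≤∣p∣ (p ℚ.- q)) d≤e)
  , ℚ-shift-≤ _ _ (solve 3 (λ p q e → e :- (:- (p :- q)) := (p :+ e) :- q) refl p q e)
      (ℚₚ.≤-trans (subst (ℚ.- (p ℚ.- q) ℚ.≤_) (ℚₚ.∣-p∣≡∣p∣ (p ℚ.- q)) (p≤∣p∣ (ℚ.- (p ℚ.- q)))) d≤e)

Close-mono : ∀ {e e′ p q} → e ℚ.≤ e′ → Close e p q → Close e′ p q
Close-mono {p = p} {q} e≤e′ (a , b) =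
  ℚₚ.≤-trans a (ℚₚ.+-monoʳ-≤ q e≤e′) , ℚₚ.≤-trans b (ℚₚ.+-monoʳ-≤ p e≤e′)

∣p*q∣≤ : ∀ {K δ} p q → ∣ p ∣ ℚ.≤ K → ∣ q ∣ ℚ.≤ δ → ∣ p ℚ.* q ∣ ℚ.≤ K ℚ.* δ
∣p*q∣≤ {K} {δ} p q p≤K q≤δ = begin
  ∣ p ℚ.* q ∣      ≡⟨ ℚₚ.∣p*q∣≡∣p∣*∣q∣ p q ⟩
  ∣ p ∣ ℚ.* ∣ q ∣  ≤⟨ ℚₚ.*-monoʳ-≤-nonNeg ∣ q ∣ {{ℚₚ.∣-∣-nonNeg q}} p≤K ⟩
  K ℚ.* ∣ q ∣      ≤⟨ *-mono-≤-nonNeg (ℚₚ.≤-trans (ℚₚ.0≤∣p∣ p) p≤K) q≤δ ⟩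
  K ℚ.* δ          ∎
  where open ℚₚ.≤-Reasoning

fromℕ : ℕ → ℚ
fromℕ n = mkℚ (ℤ.+ n) 0 (Coprime.sym (Coprime.1-coprimeTo n))

fromℕ-×ℚ : ∀ n → fromℕ n ≡ n ×ℚ 1ℚ
fromℕ-×ℚ zero    = refl
fromℕ-×ℚ (suc n) = trans (ℚₚ.toℚᵘ-injective (ℚᵘₚ.≃-sym
  (ℚᵘₚ.≃-trans (ℚₚ.toℚᵘ-homo-+ 1ℚ (fromℕ n))
    (ℚᵘ.*≡* (cong (λ k → (ℤ.+ 1 ℤ.+ k) ℤ.* ℤ.+ 1) (ℤₚ.*-identityʳ (ℤ.+ n)))))))
  (cong (1ℚ ℚ.+_) (fromℕ-×ℚ n))

-- A nonnegative fraction is at most its numerator, since its denominator is at least 1; a negative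
-- one is below 0.
archimedean : ∀ r → ∃[ n ] r ℚ.≤ n ×ℚ 1ℚ
archimedean r@(mkℚ (ℤ.+ n) d _) = n , subst (r ℚ.≤_) (fromℕ-×ℚ n)
  (ℚ.*≤* (ℤₚ.*-monoˡ-≤-nonNeg (ℤ.+ n) {ℤ.+ 1} {ℤ.+ suc d} (ℤ.+≤+ (s≤s z≤n))))
archimedean r@(mkℚ ℤ.-[1+ n ] d _) = 0 , ℚ.*≤* ℤ.-≤+

½^ : ℕ → ℚ
½^ zero    = 1ℚ
½^ (suc n) = ½ ℚ.* ½^ n

½^-nonNeg : ∀ n → 0ℚ ℚ.≤ ½^ n
½^-nonNeg zero    = 0≤1
½^-nonNeg (suc n) = ℚₚ.*-monoˡ-≤-nonNeg ½ (½^-nonNeg n)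

½^-suc-≤ : ∀ n → ½^ (suc n) ℚ.≤ ½^ n
½^-suc-≤ n = ℚₚ.≤-trans (ℚₚ.≤-reflexive (sym (ℚₚ.+-identityʳ _)))
  (ℚₚ.≤-trans (ℚₚ.+-monoʳ-≤ (½ ℚ.* ½^ n) (½^-nonNeg (suc n))) (ℚₚ.≤-reflexive (½+½ (½^ n))))

½^-antimono : ∀ {k n} → k ≤ n → ½^ n ℚ.≤ ½^ k
½^-antimono {k} k≤n = go (ℕₚ.≤⇒≤′ k≤n)
  where
  go : ∀ {n} → k ℕ.≤′ n → ½^ n ℚ.≤ ½^ k
  go ℕ.≤′-refl       = ℚₚ.≤-refl
  go (ℕ.≤′-step {n} k≤n) = ℚₚ.≤-trans (½^-suc-≤ n) (go k≤n)

-- This crude bound suffices for convergence to 0: with an integer n ≥ 1/q it yields ½^n ≤ q.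
½^*n≤1 : ∀ n → ½^ n ℚ.* (n ×ℚ 1ℚ) ℚ.≤ 1ℚ
½^*n≤1 zero    = 0≤1
½^*n≤1 (suc n) = begin
  ½ ℚ.* ½^ n ℚ.* (1ℚ ℚ.+ n ×ℚ 1ℚ)
    ≡⟨ solve 2 (λ w k → con ½ :* w :* (con 1ℚ :+ k) := con ½ :* (w :+ w :* k)) refl (½^ n) (n ×ℚ 1ℚ) ⟩
  ½ ℚ.* (½^ n ℚ.+ ½^ n ℚ.* (n ×ℚ 1ℚ))
    ≤⟨ ℚₚ.*-monoˡ-≤-nonNeg ½ (ℚₚ.+-mono-≤ (½^-antimono {0} {n} z≤n) (½^*n≤1 n)) ⟩
  1ℚ ∎
  where open ℚₚ.≤-Reasoning

-- Properties of all large indices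

Eventually : Pred ℕ 0ℓ → Set
Eventually P = ∃[ N ] ∀ n → N ≤ n → P n

ev-map : {P P′ : Pred ℕ 0ℓ} → (∀ {n} → P n → P′ n) → Eventually P → Eventually P′
ev-map f (N , p) = N , λ n N≤n → f (p n N≤n)

ev-∩ : {P P′ : Pred ℕ 0ℓ} → Eventually P → Eventually P′ → Eventually (P ∩ P′)
ev-∩ (N , p) (N′ , p′) = N ℕ.⊔ N′ , λ n N≤n →
  p n (ℕₚ.m⊔n≤o⇒m≤o N N′ N≤n) , p′ n (ℕₚ.m⊔n≤o⇒n≤o N N′ N≤n)

ev-∀ : {P : Fin m → Pred ℕ 0ℓ} → (∀ i → Eventually (P i)) → Eventually (λ n → ∀ i → P i n)
ev-∀ {zero}  p = 0 , λ _ _ ()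
ev-∀ {suc m} p = ev-map (λ { (p₀ , pₛ) zero → p₀ ; (p₀ , pₛ) (suc i) → pₛ i }) (ev-∩ (p zero) (ev-∀ (p ∘ suc)))

ev-witness : {P : Pred ℕ 0ℓ} → Eventually P → ∃ P
ev-witness (N , p) = N , p N ℕₚ.≤-refl

½^-eventually-≤ : ∀ {q} → 0ℚ ℚ.< q → Eventually (λ n → ½^ n ℚ.≤ q)
½^-eventually-≤ {q} 0<q with n , 1/q≤n ← archimedean ((ℚ.1/ q) {{ℚₚ.pos⇒nonZero q {{ℚ.positive 0<q}}}}) =
  n , λ k n≤k → ℚₚ.≤-trans (½^-antimono n≤k) (begin
    ½^ n                             ≡⟨ ℚₚ.*-identityʳ (½^ n) ⟨
    ½^ n ℚ.* 1ℚ                      ≡⟨ cong (½^ n ℚ.*_) (ℚₚ.*-inverseˡ q) ⟨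
    ½^ n ℚ.* (ℚ.1/ q ℚ.* q)          ≤⟨ *-mono-≤-nonNeg (½^-nonNeg n) (ℚₚ.*-monoʳ-≤-nonNeg q 1/q≤n) ⟩
    ½^ n ℚ.* (n ×ℚ 1ℚ ℚ.* q)         ≡⟨ ℚₚ.*-assoc (½^ n) (n ×ℚ 1ℚ) q ⟨
    ½^ n ℚ.* (n ×ℚ 1ℚ) ℚ.* q         ≤⟨ ℚₚ.*-monoʳ-≤-nonNeg q (½^*n≤1 n) ⟩
    1ℚ ℚ.* q                         ≡⟨ ℚₚ.*-identityˡ q ⟩
    q                                ∎)
  where
  open ℚₚ.≤-Reasoning
  instance
    q-pos : ℚ.Positive q
    q-pos = ℚ.positive 0<q
    q-nonNeg : ℚ.NonNegative q
    q-nonNeg = ℚ.nonNegative (ℚₚ.<⇒≤ 0<q)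
    q-nonZero : ℚ.NonZero q
    q-nonZero = ℚₚ.pos⇒nonZero q

-- Integer linear forms

dotℚ : Vec ℕ m → Vector ℚ m → ℚ
dotℚ u q = sumℚ λ i → lookup u i ×ℚ q i

sample : ℝ^ m → ℕ → Vector ℚ m
sample z n i = seq (z i) n

seq-sum : (x : ℝ^ m) → ∀ n → seq (sum x) n ≡ sumℚ (sample x n)
seq-sum {zero}  x n = refl
seq-sum {suc m} x n = cong (seq (x zero) n ℚ.+_) (seq-sum (x ∘ suc) n)

seq-· : ∀ k x n → seq (k · x) n ≡ k ×ℚ seq x n
seq-· zero    x n = refl
seq-· (suc k) x n = cong (seq x n ℚ.+_) (seq-· k x n)

-- Real sums and multiples are formed term by term. Through this identity the order between real
-- linear forms becomes a margin between rational forms at large indices.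
seq-dot : (u : Vec ℕ m) (z : ℝ^ m) → ∀ n → seq (dot u z) n ≡ dotℚ u (sample z n)
seq-dot {m} u z n = trans (seq-sum (λ i → lookup u i · z i) n) (sum-cong-≗ {m} λ i → seq-· (lookup u i) (z i) n)

dotℚ-cong : (u : Vec ℕ m) {q r : Vector ℚ m} → (∀ i → q i ≡ r i) → dotℚ u q ≡ dotℚ u r
dotℚ-cong {m} u eq = sum-cong-≗ {m} λ i → cong (lookup u i ×ℚ_) (eq i)

dotℚ-⊕ : (a b : Vec ℕ m) (q : Vector ℚ m) → dotℚ (a ⊕ b) q ≡ dotℚ a q ℚ.+ dotℚ b q
dotℚ-⊕ {m} a b q = trans
  (sum-cong-≗ {m} λ i → trans (cong (_×ℚ q i) (Vecₚ.lookup-zipWith ℕ._+_ i a b)) (×-homo-+ (q i) (lookup a i) (lookup b i)))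
  (∑-distrib-+ (λ i → lookup a i ×ℚ q i) (λ i → lookup b i ×ℚ q i))

dotℚ-+ : (u : Vec ℕ m) (q r : Vector ℚ m) → dotℚ u (λ i → q i ℚ.+ r i) ≡ dotℚ u q ℚ.+ dotℚ u r
dotℚ-+ {m} u q r = trans (sum-cong-≗ {m} λ i → ×-distrib-+ (q i) (r i) (lookup u i))
  (∑-distrib-+ (λ i → lookup u i ×ℚ q i) (λ i → lookup u i ×ℚ r i))

×ℚ-* : ∀ k s q → k ×ℚ (s ℚ.* q) ≡ s ℚ.* (k ×ℚ q)
×ℚ-* zero    s q = sym (ℚₚ.*-zeroʳ s)
×ℚ-* (suc k) s q = trans (cong (s ℚ.* q ℚ.+_) (×ℚ-* k s q)) (sym (ℚₚ.*-distribˡ-+ s q (k ×ℚ q)))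

dotℚ-* : (u : Vec ℕ m) (s : ℚ) (q : Vector ℚ m) → dotℚ u (λ i → s ℚ.* q i) ≡ s ℚ.* dotℚ u q
dotℚ-* {m} u s q = trans (sum-cong-≗ {m} λ i → ×ℚ-* (lookup u i) s (q i)) (sym (*-distribˡ-sum s (λ i → lookup u i ×ℚ q i)))

×ℚ-mono : ∀ k {p q} → p ℚ.≤ q → k ×ℚ p ℚ.≤ k ×ℚ q
×ℚ-mono zero    p≤q = ℚₚ.≤-refl
×ℚ-mono (suc k) p≤q = ℚₚ.+-mono-≤ p≤q (×ℚ-mono k p≤q)

dotℚ-mono : (u : Vec ℕ m) {q r : Vector ℚ m} → (∀ i → q i ℚ.≤ r i) → dotℚ u q ℚ.≤ dotℚ u r
dotℚ-mono []      q≤r = ℚₚ.≤-refl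
dotℚ-mono (x ∷ u) q≤r = ℚₚ.+-mono-≤ (×ℚ-mono x (q≤r zero)) (dotℚ-mono u (q≤r ∘ suc))

dotℚ-0 : (u : Vec ℕ m) → dotℚ u (λ _ → 0ℚ) ≡ 0ℚ
dotℚ-0 u = trans (dotℚ-* u 0ℚ (λ _ → 0ℚ)) (ℚₚ.*-zeroˡ (dotℚ u (λ _ → 0ℚ)))

dotℚ-𝟎 : (q : Vector ℚ m) → dotℚ 𝟎 q ≡ 0ℚ
dotℚ-𝟎 {zero}  q = refl
dotℚ-𝟎 {suc m} q = trans (ℚₚ.+-identityˡ _) (dotℚ-𝟎 (q ∘ suc))

dotℚ-nonNeg : (u : Vec ℕ m) {q : Vector ℚ m} → (∀ i → 0ℚ ℚ.≤ q i) → 0ℚ ℚ.≤ dotℚ u q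
dotℚ-nonNeg u {q} 0≤q = subst (ℚ._≤ dotℚ u q) (dotℚ-0 u) (dotℚ-mono u 0≤q)

-- A nonzero natural coefficient is at least 1 and the remaining terms are nonnegative.
dotℚ-lower : (u : Vec ℕ m) {q : Vector ℚ m} → (∀ i → 0ℚ ℚ.≤ q i) → ∀ i → lookup u i ≢ 0 → q i ℚ.≤ dotℚ u q
dotℚ-lower (zero  ∷ u) 0≤q zero    u₀≢0 = contradiction refl u₀≢0
dotℚ-lower (suc x ∷ u) {q} 0≤q zero u₀≢0 = begin
  q zero                         ≡⟨ ℚₚ.+-identityʳ (q zero) ⟨
  q zero ℚ.+ 0ℚ                  ≤⟨ ℚₚ.+-monoʳ-≤ (q zero) (dotℚ-nonNeg (x ∷ u) 0≤q) ⟩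
  q zero ℚ.+ (x ×ℚ q zero ℚ.+ dotℚ u (q ∘ suc))   ≡⟨ ℚₚ.+-assoc (q zero) (x ×ℚ q zero) _ ⟨
  (q zero ℚ.+ x ×ℚ q zero) ℚ.+ dotℚ u (q ∘ suc)   ∎
  where open ℚₚ.≤-Reasoning
dotℚ-lower (x ∷ u) {q} 0≤q (suc i) uᵢ≢0 = begin
  q (suc i)                            ≤⟨ dotℚ-lower u (0≤q ∘ suc) i uᵢ≢0 ⟩
  dotℚ u (q ∘ suc)                     ≡⟨ ℚₚ.+-identityˡ _ ⟨
  0ℚ ℚ.+ dotℚ u (q ∘ suc)              ≤⟨ ℚₚ.+-monoˡ-≤ _ (subst (ℚ._≤ x ×ℚ q zero) (×ℚ-zero x) (×ℚ-mono x (0≤q zero))) ⟩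
  x ×ℚ q zero ℚ.+ dotℚ u (q ∘ suc)     ∎
  where
  open ℚₚ.≤-Reasoning
  ×ℚ-zero : ∀ x → x ×ℚ 0ℚ ≡ 0ℚ
  ×ℚ-zero x = trans (×ℚ-* x 0ℚ 0ℚ) (ℚₚ.*-zeroˡ (x ×ℚ 0ℚ))

dotℚ-unit : (i : Fin m) (q : Vector ℚ m) → dotℚ (unit i) q ≡ q i
dotℚ-unit {suc m} zero q = trans (cong ((q zero ℚ.+ 0ℚ) ℚ.+_) (dotℚ-𝟎 (q ∘ suc)))
                           (trans (ℚₚ.+-identityʳ _) (ℚₚ.+-identityʳ _))
dotℚ-unit (suc i) q = trans (ℚₚ.+-identityˡ _) (dotℚ-unit i (q ∘ suc))

×ℚ1-< : ∀ {x y} → x ℕ.< y → x ×ℚ 1ℚ ℚ.< y ×ℚ 1ℚ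
×ℚ1-< {zero}  {suc y} _         = ℚₚ.+-mono-<-≤ (ℚₚ.positive⁻¹ 1ℚ) (nonNeg y)
  where
  nonNeg : ∀ y → 0ℚ ℚ.≤ y ×ℚ 1ℚ
  nonNeg zero    = ℚₚ.≤-refl
  nonNeg (suc y) = ℚₚ.+-mono-≤ 0≤1 (nonNeg y)
×ℚ1-< {suc x} {suc y} (s≤s x<y) = ℚₚ.+-monoʳ-< 1ℚ (×ℚ1-< x<y)

×ℚ1-injective : ∀ x y → x ×ℚ 1ℚ ≡ y ×ℚ 1ℚ → x ≡ y
×ℚ1-injective x y eq with ℕₚ.<-cmp x y
... | tri< x<y _ _ = contradiction (×ℚ1-< x<y) (ℚₚ.<-irrefl eq)
... | tri≈ _ x≡y _ = x≡y
... | tri> _ _ y<x = contradiction (×ℚ1-< y<x) (ℚₚ.<-irrefl (sym eq))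

-- The first basis vector isolates the heads, and vectors with first coordinate 0 isolate the tails.
dotℚ-injective : (a b : Vec ℕ m) → (∀ q → dotℚ a q ≡ dotℚ b q) → a ≡ b
dotℚ-injective []      []      _  = refl
dotℚ-injective (x ∷ a) (y ∷ b) eq = cong₂ _∷_
  (×ℚ1-injective x y (trans (sym (head-1 x a)) (trans (eq (cons 1ℚ λ _ → 0ℚ)) (head-1 y b))))
  (dotℚ-injective a b λ q → trans (sym (head-0 x a q)) (trans (eq (cons 0ℚ q)) (head-0 y b q)))
  where
  cons : ℚ → Vector ℚ n → Vector ℚ (suc n)
  cons p q zero    = p
  cons p q (suc i) = q i
  head-1 : ∀ x (a : Vec ℕ n) → dotℚ (x ∷ a) (cons 1ℚ λ _ → 0ℚ) ≡ x ×ℚ 1ℚ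
  head-1 x a = trans (cong (x ×ℚ 1ℚ ℚ.+_) (dotℚ-0 a)) (ℚₚ.+-identityʳ _)
  head-0 : ∀ x (a : Vec ℕ n) q → dotℚ (x ∷ a) (cons 0ℚ q) ≡ dotℚ a q
  head-0 x a q = trans (cong (ℚ._+ dotℚ a q) (trans (×ℚ-* x 0ℚ 0ℚ) (ℚₚ.*-zeroˡ (x ×ℚ 0ℚ)))) (ℚₚ.+-identityˡ _)

-- The constant is the sum of the coefficients, the Lipschitz constant of the form in the maximum
-- norm. One-sided closeness is enough because the coefficients are nonnegative.
dotℚ-close : (u : Vec ℕ m) {q r : Vector ℚ m} {e : ℚ} → (∀ i → q i ℚ.≤ r i ℚ.+ e) →
  dotℚ u q ℚ.≤ dotℚ u r ℚ.+ dotℚ u (λ _ → 1ℚ) ℚ.* e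
dotℚ-close u {q} {r} {e} q≤r+e = begin
  dotℚ u q                                            ≤⟨ dotℚ-mono u q≤r+e ⟩
  dotℚ u (λ i → r i ℚ.+ e)                            ≡⟨ dotℚ-+ u r (λ _ → e) ⟩
  dotℚ u r ℚ.+ dotℚ u (λ _ → e)                       ≡⟨ cong (dotℚ u r ℚ.+_) (dotℚ-cong u λ _ → sym (ℚₚ.*-identityʳ e)) ⟩
  dotℚ u r ℚ.+ dotℚ u (λ _ → e ℚ.* 1ℚ)                ≡⟨ cong (dotℚ u r ℚ.+_) (dotℚ-* u e (λ _ → 1ℚ)) ⟩
  dotℚ u r ℚ.+ e ℚ.* dotℚ u (λ _ → 1ℚ)                ≡⟨ cong (dotℚ u r ℚ.+_) (ℚₚ.*-comm e _) ⟩
  dotℚ u r ℚ.+ dotℚ u (λ _ → 1ℚ) ℚ.* e                ∎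
  where open ℚₚ.≤-Reasoning

-- Order and equality of reals

-- Halving the margin recovers the strict inequality in `_<ᴿ_`, so that estimates can be made with
-- weak ones.
<ᴿ-intro : ∀ {x y δ} → 0ℚ ℚ.< δ → Eventually (λ n → seq x n ℚ.+ δ ℚ.≤ seq y n) → x <ᴿ y
<ᴿ-intro {x} {δ = δ} 0<δ ev =
  ½ ℚ.* δ , ½-pos 0<δ , ev-map (λ {n} → ℚₚ.<-≤-trans (ℚₚ.+-monoʳ-< (seq x n) (½-< 0<δ))) ev

<ᴿ-resp : ∀ {x y x′ y′} → (∀ n → seq x n ≡ seq x′ n) → (∀ n → seq y n ≡ seq y′ n) → x <ᴿ y → x′ <ᴿ y′
<ᴿ-resp x≡ y≡ (ε , 0<ε , ev) =
  ε , 0<ε , ev-map (λ {n} → subst₂ (λ p q → p ℚ.+ ε ℚ.< q) (x≡ n) (y≡ n)) ev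

<ᴿ-trans : ∀ {x y z} → x <ᴿ y → y <ᴿ z → x <ᴿ z
<ᴿ-trans {x} {y} (ε , 0<ε , ev) (ε′ , 0<ε′ , ev′) = ε , 0<ε ,
  ev-map (λ {n} (p , q) → ℚₚ.<-trans p (ℚₚ.<-trans (p<p+ε (seq y n) 0<ε′) q)) (ev-∩ ev ev′)

<ᴿ-irrefl : ∀ {x} → ¬ x <ᴿ x
<ᴿ-irrefl {x} (ε , 0<ε , ev) with n , p ← ev-witness ev =
  ℚₚ.<-irrefl refl (ℚₚ.<-trans (p<p+ε (seq x n) 0<ε) p)

<ᴿ-asym : ∀ {x y} → x <ᴿ y → ¬ y <ᴿ x
<ᴿ-asym {x} {y} x<y y<x = <ᴿ-irrefl {x} (<ᴿ-trans {x} {y} {x} x<y y<x)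

infix 4 _⊨_≺_

_⊨_≺_ : ℝ^ m → Vec ℕ m → Vec ℕ m → Set
z ⊨ a ≺ b = dot a z <ᴿ dot b z

≺-intro : ∀ {z : ℝ^ m} {a b δ} → 0ℚ ℚ.< δ →
  Eventually (λ n → dotℚ a (sample z n) ℚ.+ δ ℚ.≤ dotℚ b (sample z n)) → z ⊨ a ≺ b
≺-intro {z = z} {a} {b} {δ} 0<δ ev = <ᴿ-intro {dot a z} {dot b z} 0<δ
  (ev-map (λ {n} → subst₂ (λ p q → p ℚ.+ δ ℚ.≤ q) (sym (seq-dot a z n)) (sym (seq-dot b z n))) ev)

≺-elim : ∀ {z : ℝ^ m} {a b} → z ⊨ a ≺ b →
  ∃[ δ ] 0ℚ ℚ.< δ × Eventually (λ n → dotℚ a (sample z n) ℚ.+ δ ℚ.≤ dotℚ b (sample z n))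
≺-elim {z = z} {a} {b} (δ , 0<δ , ev) = δ , 0<δ ,
  ev-map (λ {n} p → subst₂ (λ p q → p ℚ.+ δ ℚ.≤ q) (seq-dot a z n) (seq-dot b z n) (ℚₚ.<⇒≤ p)) ev

≺-⊕ : ∀ {z : ℝ^ m} {a b} c → z ⊨ a ≺ b → z ⊨ a ⊕ c ≺ b ⊕ c
≺-⊕ {z = z} {a} {b} c a≺b = let δ , 0<δ , ev = ≺-elim {z = z} {a} {b} a≺b in
  ≺-intro {z = z} {a ⊕ c} {b ⊕ c} 0<δ (ev-map (λ {n} → pointwise (sample z n) δ) ev)
  where
  add : ∀ a b c δ → a ℚ.+ δ ℚ.≤ b → (a ℚ.+ c) ℚ.+ δ ℚ.≤ b ℚ.+ c
  add a b c δ = ℚ-shift-≤ {a ℚ.+ δ} {b} ((a ℚ.+ c) ℚ.+ δ) (b ℚ.+ c)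
    (solve 4 (λ a b c δ → b :- (a :+ δ) := (b :+ c) :- ((a :+ c) :+ δ)) refl a b c δ)
  pointwise : ∀ q δ → dotℚ a q ℚ.+ δ ℚ.≤ dotℚ b q → dotℚ (a ⊕ c) q ℚ.+ δ ℚ.≤ dotℚ (b ⊕ c) q
  pointwise q δ p = subst₂ (λ s t → s ℚ.+ δ ℚ.≤ t) (sym (dotℚ-⊕ a c q)) (sym (dotℚ-⊕ b c q))
    (add (dotℚ a q) (dotℚ b q) (dotℚ c q) δ p)

≺-⊕⁻¹ : ∀ {z : ℝ^ m} {a b} c → z ⊨ a ⊕ c ≺ b ⊕ c → z ⊨ a ≺ b
≺-⊕⁻¹ {z = z} {a} {b} c ac≺bc = let δ , 0<δ , ev = ≺-elim {z = z} {a ⊕ c} {b ⊕ c} ac≺bc in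
  ≺-intro {z = z} {a} {b} 0<δ (ev-map (λ {n} → pointwise (sample z n) δ) ev)
  where
  cancel : ∀ a b c δ → (a ℚ.+ c) ℚ.+ δ ℚ.≤ b ℚ.+ c → a ℚ.+ δ ℚ.≤ b
  cancel a b c δ = ℚ-shift-≤ {(a ℚ.+ c) ℚ.+ δ} {b ℚ.+ c} (a ℚ.+ δ) b
    (solve 4 (λ a b c δ → (b :+ c) :- ((a :+ c) :+ δ) := b :- (a :+ δ)) refl a b c δ)
  pointwise : ∀ q δ → dotℚ (a ⊕ c) q ℚ.+ δ ℚ.≤ dotℚ (b ⊕ c) q → dotℚ a q ℚ.+ δ ℚ.≤ dotℚ b q
  pointwise q δ p = cancel (dotℚ a q) (dotℚ b q) (dotℚ c q) δ
    (subst₂ (λ s t → s ℚ.+ δ ℚ.≤ t) (dotℚ-⊕ a c q) (dotℚ-⊕ b c q) p)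

≈ᴿ-intro : ∀ {x y} → (∀ ε → 0ℚ ℚ.< ε → Eventually (λ n → ∣ seq x n ℚ.- seq y n ∣ ℚ.≤ ε)) → x ≈ᴿ y
≈ᴿ-intro f ε 0<ε = ev-map (λ p → ℚₚ.≤-<-trans p (½-< 0<ε)) (f (½ ℚ.* ε) (½-pos 0<ε))

≗⇒≈ᴿ : ∀ {x y} → (∀ n → seq x n ≡ seq y n) → x ≈ᴿ y
≗⇒≈ᴿ {x} {y} eq ε 0<ε = 0 , λ n _ → subst (ℚ._< ε)
  (sym (cong ∣_∣ (trans (cong (ℚ._- seq y n) (eq n)) (ℚₚ.+-inverseʳ (seq y n))))) 0<ε

≈ᴿ-trans : ∀ {x y z} → x ≈ᴿ y → y ≈ᴿ z → x ≈ᴿ z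
≈ᴿ-trans {x} {y} {z} x≈y y≈z ε 0<ε =
  ev-map (λ {n} (p , q) → pointwise (seq x n) (seq y n) (seq z n) p q)
    (ev-∩ (x≈y (½ ℚ.* ε) (½-pos 0<ε)) (y≈z (½ ℚ.* ε) (½-pos 0<ε)))
  where
  pointwise : ∀ a b c → ∣ a ℚ.- b ∣ ℚ.< ½ ℚ.* ε → ∣ b ℚ.- c ∣ ℚ.< ½ ℚ.* ε → ∣ a ℚ.- c ∣ ℚ.< ε
  pointwise a b c p q = begin-strict
    ∣ a ℚ.- c ∣                    ≡⟨ cong ∣_∣ (solve 3 (λ a b c → a :- c := (a :- b) :+ (b :- c)) refl a b c) ⟩
    ∣ (a ℚ.- b) ℚ.+ (b ℚ.- c) ∣    ≤⟨ ℚₚ.∣p+q∣≤∣p∣+∣q∣ (a ℚ.- b) (b ℚ.- c) ⟩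
    ∣ a ℚ.- b ∣ ℚ.+ ∣ b ℚ.- c ∣    <⟨ ℚₚ.+-mono-< p q ⟩
    ½ ℚ.* ε ℚ.+ ½ ℚ.* ε            ≡⟨ ½+½ ε ⟩
    ε                              ∎
    where open ℚₚ.≤-Reasoning

+ᴿ-cong : ∀ {x y x′ y′} → x ≈ᴿ x′ → y ≈ᴿ y′ → x +ᴿ y ≈ᴿ x′ +ᴿ y′
+ᴿ-cong {x} {y} {x′} {y′} x≈ y≈ ε 0<ε =
  ev-map (λ {n} (p , q) → pointwise (seq x n) (seq y n) (seq x′ n) (seq y′ n) p q)
    (ev-∩ (x≈ (½ ℚ.* ε) (½-pos 0<ε)) (y≈ (½ ℚ.* ε) (½-pos 0<ε)))
  where
  pointwise : ∀ a b c d → ∣ a ℚ.- c ∣ ℚ.< ½ ℚ.* ε → ∣ b ℚ.- d ∣ ℚ.< ½ ℚ.* ε → ∣ (a ℚ.+ b) ℚ.- (c ℚ.+ d) ∣ ℚ.< ε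
  pointwise a b c d p q = begin-strict
    ∣ (a ℚ.+ b) ℚ.- (c ℚ.+ d) ∣    ≡⟨ cong ∣_∣ (solve 4 (λ a b c d → (a :+ b) :- (c :+ d) := (a :- c) :+ (b :- d)) refl a b c d) ⟩
    ∣ (a ℚ.- c) ℚ.+ (b ℚ.- d) ∣    ≤⟨ ℚₚ.∣p+q∣≤∣p∣+∣q∣ (a ℚ.- c) (b ℚ.- d) ⟩
    ∣ a ℚ.- c ∣ ℚ.+ ∣ b ℚ.- d ∣    <⟨ ℚₚ.+-mono-< p q ⟩
    ½ ℚ.* ε ℚ.+ ½ ℚ.* ε            ≡⟨ ½+½ ε ⟩
    ε                              ∎
    where open ℚₚ.≤-Reasoning

sum-cong-≈ᴿ : {x y : ℝ^ m} → (∀ i → x i ≈ᴿ y i) → sum x ≈ᴿ sum y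
sum-cong-≈ᴿ {zero}          eq = ≗⇒≈ᴿ {0ℝ} {0ℝ} λ _ → refl
sum-cong-≈ᴿ {suc m} {x} {y} eq =
  +ᴿ-cong {x zero} {sum (x ∘ suc)} {y zero} {sum (y ∘ suc)} (eq zero) (sum-cong-≈ᴿ {x = x ∘ suc} {y ∘ suc} (eq ∘ suc))

*ᴿ-congˡ : ∀ t {x y} → x ≈ᴿ y → t *ᴿ x ≈ᴿ t *ᴿ y
*ᴿ-congˡ t {x} {y} x≈y = ≈ᴿ-intro {t *ᴿ x} {t *ᴿ y} λ ε 0<ε →
  let K , 0<K , bound = eventually-bounded t
      δ , 0<δ , K*δ≤ε = ∃-small-multiple (ℚₚ.<⇒≤ 0<K) 0<ε
  in ev-map (λ {n} (p , q) → ℚₚ.≤-trans (pointwise (seq t n) (seq x n) (seq y n) (ℚₚ.<⇒≤ p) (ℚₚ.<⇒≤ q)) K*δ≤ε)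
       (ev-∩ bound (x≈y δ 0<δ))
  where
  pointwise : ∀ {K δ} t x y → ∣ t ∣ ℚ.≤ K → ∣ x ℚ.- y ∣ ℚ.≤ δ → ∣ t ℚ.* x ℚ.- t ℚ.* y ∣ ℚ.≤ K ℚ.* δ
  pointwise {K} {δ} t x y p q = subst (λ s → ∣ s ∣ ℚ.≤ K ℚ.* δ)
    (solve 3 (λ t x y → t :* (x :- y) := t :* x :- t :* y) refl t x y) (∣p*q∣≤ t (x ℚ.- y) p q)

combination : Vector ℝ n → Vector (ℝ^ m) n → ℝ^ m
combination t p j = sum λ i → t i *ᴿ p i j

weightedSums : Vector ℝ n → Vector (ℝ^ m) n → ℝ^ n
weightedSums t p i = t i *ᴿ sum (p i)

sum-combination : (t : Vector ℝ n) (p : Vector (ℝ^ m) n) → sum (combination t p) ≈ᴿ sum (weightedSums t p)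
sum-combination {n} {m} t p = ≗⇒≈ᴿ {sum (combination t p)} {sum (weightedSums t p)} λ k → begin
  seq (sum (combination t p)) k                                ≡⟨ seq-sum {m} (combination t p) k ⟩
  sumℚ (sample (combination t p) k)                            ≡⟨ sum-cong-≗ {m} (λ j → seq-sum {n} _ k) ⟩
  sumℚ (λ j → sumℚ λ i → sample t k i ℚ.* sample (p i) k j)    ≡⟨ ∑-comm {m} {n} (λ j i → sample t k i ℚ.* sample (p i) k j) ⟩
  sumℚ (λ i → sumℚ λ j → sample t k i ℚ.* sample (p i) k j)    ≡⟨ sum-cong-≗ {n} (λ i → weighted (t i) (p i) k) ⟨
  sumℚ (sample (weightedSums t p) k)                           ≡⟨ seq-sum {n} (weightedSums t p) k ⟨
  seq (sum (weightedSums t p)) k                               ∎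
  where
  open ≡-Reasoning
  seq-* : ∀ x y k → seq (x *ᴿ y) k ≡ seq x k ℚ.* seq y k
  seq-* x y k = refl
  weighted : ∀ s (x : ℝ^ m) k → seq (s *ᴿ sum x) k ≡ sumℚ (λ j → seq s k ℚ.* sample x k j)
  weighted s x k = trans (seq-* s (sum x) k) (trans (cong (seq s k ℚ.*_) (seq-sum x k)) (*-distribˡ-sum (seq s k) (sample x k)))

-- Interchanging the two sums leaves a combination of ones whose weights sum to 1. This serves both
-- segments and the affine hull of a region.
affineHull-sum : {y : ℝ^ m} → AffineHull (λ x → sum x ≈ᴿ 1ℝ) y → sum y ≈ᴿ 1ℝ
affineHull-sum {m} {y} (k , t , p , p-sum , t-sum , y≈) =
  ≈ᴿ-trans {sum y} {sum (combination t p)} {1ℝ} (sum-cong-≈ᴿ {m} {y} {combination t p} y≈)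
  (≈ᴿ-trans {sum (combination t p)} {sum (weightedSums t p)} {1ℝ} (sum-combination t p)
  (≈ᴿ-trans {sum (weightedSums t p)} {sum t} {1ℝ} (sum-cong-≈ᴿ {k} {weightedSums t p} {t} weight) t-sum))
  where
  weight : ∀ i → weightedSums t p i ≈ᴿ t i
  weight i = ≈ᴿ-trans {t i *ᴿ sum (p i)} {t i *ᴿ 1ℝ} {t i} (*ᴿ-congˡ (t i) {sum (p i)} {1ℝ} (p-sum i))
    (≗⇒≈ᴿ {t i *ᴿ 1ℝ} {t i} λ n → ℚₚ.*-identityʳ (seq (t i) n))

-- Neighbourhoods of rational radius

-- Closeness of the rational terms stands in for the real ball, so that continuity estimates involve
-- only rationals.
Near : ℚ → ℝ^ m → Pred (ℝ^ m) 0ℓ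
Near e x y = ∀ i → Eventually (λ n → Close e (seq (x i) n) (seq (y i) n))

Nbhd : ℝ^ m → Pred (ℝ^ m) 0ℓ → Set
Nbhd x V = ∃[ e ] 0ℚ ℚ.< e × Near e x ⊆ V

Ball⇒Near : ∀ {e} {x y : ℝ^ m} → Ball (fromℚ e) x y → Near e x y
Ball⇒Near {e = e} {x} {y} ball i = let (δ , 0<δ , p) , (δ′ , 0<δ′ , p′) = ball i in
  ev-map (λ {n} (q , q′) → ℚₚ.<⇒≤ (ℚₚ.<-trans (p<p+ε (seq (x i) n) 0<δ) q)
                         , ℚₚ.<⇒≤ (ℚₚ.<-trans (p<p+ε (seq (y i) n) 0<δ′) q′)) (ev-∩ p p′)

Nbhd⇒Ball : ∀ {x : ℝ^ m} {V} → Nbhd x V → ∃[ ε ] 0ℝ <ᴿ ε × Ball ε x ⊆ V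
Nbhd⇒Ball {x = x} (e , 0<e , V⊇) = fromℚ e
  , <ᴿ-intro {0ℝ} {fromℚ e} 0<e (0 , λ _ _ → ℚₚ.≤-reflexive (ℚₚ.+-identityˡ e))
  , λ {y} ball → V⊇ {y} (Ball⇒Near {x = x} {y} ball)

Open⇒Nbhd : ∀ {V : Pred (ℝ^ m) 0ℓ} {x} → Open V → V x → Nbhd x V
Open⇒Nbhd {m} {V} {x} V-open Vx = let ε , (δ , 0<δ , ev) , V⊇ = V-open {x} Vx in
  -- The rational δ lies below the real radius ε. One half of it bounds the distance, the other half
  -- is the margin of the strict inequality.
  ½ ℚ.* δ , ½-pos 0<δ , λ {y} near → V⊇ {y} λ i →
      below ε δ 0<δ ev (x i) (y i) (ev-map proj₁ (near i)) , below ε δ 0<δ ev (y i) (x i) (ev-map proj₂ (near i))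
  where
  pointwise : ∀ x y ε δ → x ℚ.≤ y ℚ.+ ½ ℚ.* δ → 0ℚ ℚ.+ δ ℚ.< ε → x ℚ.+ ½ ℚ.* δ ℚ.≤ y ℚ.+ ε
  pointwise x y ε δ p q = begin
    x ℚ.+ ½ ℚ.* δ                    ≤⟨ ℚₚ.+-monoˡ-≤ (½ ℚ.* δ) p ⟩
    y ℚ.+ ½ ℚ.* δ ℚ.+ ½ ℚ.* δ        ≡⟨ ℚₚ.+-assoc y (½ ℚ.* δ) (½ ℚ.* δ) ⟩
    y ℚ.+ (½ ℚ.* δ ℚ.+ ½ ℚ.* δ)      ≡⟨ cong (y ℚ.+_) (trans (½+½ δ) (sym (ℚₚ.+-identityˡ δ))) ⟩
    y ℚ.+ (0ℚ ℚ.+ δ)                 ≤⟨ ℚₚ.+-monoʳ-≤ y (ℚₚ.<⇒≤ q) ⟩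
    y ℚ.+ ε                          ∎
    where open ℚₚ.≤-Reasoning
  below : ∀ ε δ → 0ℚ ℚ.< δ → Eventually (λ n → 0ℚ ℚ.+ δ ℚ.< seq ε n) → ∀ x y →
    Eventually (λ n → seq x n ℚ.≤ seq y n ℚ.+ ½ ℚ.* δ) → x <ᴿ y +ᴿ ε
  below ε δ 0<δ ev x y p = <ᴿ-intro {x} {y +ᴿ ε} (½-pos 0<δ)
    (ev-map (λ {n} (q , r) → pointwise (seq x n) (seq y n) (seq ε n) δ q r) (ev-∩ p ev))

-- Moving every coordinate by at most e changes a·z by at most K e and b·z by at most L e, so half
-- of the margin δ survives if (K + L) e ≤ δ/2.
Nbhd-≺ : ∀ {x : ℝ^ m} {a b} → x ⊨ a ≺ b → Nbhd x (_⊨ a ≺ b)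
Nbhd-≺ {m} {x} {a} {b} a≺b =
  let δ , 0<δ , ev  = ≺-elim {z = x} {a} {b} a≺b
      e , 0<e , Ke≤ = ∃-small-multiple 0≤K+L (½-pos 0<δ)
  in e , 0<e , λ {y} near → ≺-intro {z = y} {a} {b} (½-pos 0<δ)
       (ev-map (λ {n} (p , c) → pointwise (sample x n) (sample y n) e δ p c Ke≤) (ev-∩ ev (ev-∀ near)))
  where
  K = dotℚ a (λ _ → 1ℚ)
  L = dotℚ b (λ _ → 1ℚ)
  0≤K+L : 0ℚ ℚ.≤ K ℚ.+ L
  0≤K+L = ℚₚ.+-mono-≤ (dotℚ-nonNeg a (λ _ → 0≤1)) (dotℚ-nonNeg b (λ _ → 0≤1))
  estimate : ∀ K L e δ ax bx ay by → ax ℚ.+ δ ℚ.≤ bx → ay ℚ.≤ ax ℚ.+ K ℚ.* e → bx ℚ.≤ by ℚ.+ L ℚ.* e →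
    (K ℚ.+ L) ℚ.* e ℚ.≤ ½ ℚ.* δ → ay ℚ.+ ½ ℚ.* δ ℚ.≤ by
  estimate K L e δ ax bx ay by p q r s =
    ℚ-shift-≤ {bx ℚ.+ ay ℚ.+ (ax ℚ.+ δ) ℚ.+ (K ℚ.+ L) ℚ.* e}
              {(by ℚ.+ L ℚ.* e) ℚ.+ (ax ℚ.+ K ℚ.* e) ℚ.+ bx ℚ.+ ½ ℚ.* δ} (ay ℚ.+ ½ ℚ.* δ) by
      (solve 8 (λ ax bx ay by K L e δ →
          ((by :+ L :* e) :+ (ax :+ K :* e) :+ bx :+ con ½ :* δ) :- (bx :+ ay :+ (ax :+ δ) :+ (K :+ L) :* e)
          := by :- (ay :+ con ½ :* δ)) refl ax bx ay by K L e δ)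
      (ℚₚ.+-mono-≤ (ℚₚ.+-mono-≤ (ℚₚ.+-mono-≤ r q) p) s)
  pointwise : ∀ (q r : Vector ℚ m) e δ → dotℚ a q ℚ.+ δ ℚ.≤ dotℚ b q → (∀ i → Close e (q i) (r i)) →
    (K ℚ.+ L) ℚ.* e ℚ.≤ ½ ℚ.* δ → dotℚ a r ℚ.+ ½ ℚ.* δ ℚ.≤ dotℚ b r
  pointwise q r e δ p c = estimate K L e δ (dotℚ a q) (dotℚ b q) (dotℚ a r) (dotℚ b r)
    p (dotℚ-close a (proj₂ ∘ c)) (dotℚ-close b (proj₁ ∘ c))

Open-≺ : (a b : Vec ℕ m) → Open (_⊨ a ≺ b)
Open-≺ a b {x} a≺b = Nbhd⇒Ball {x = x} {_⊨ a ≺ b} (Nbhd-≺ {x = x} {a} {b} a≺b)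

Nbhd-map : ∀ {x : ℝ^ m} {V W : Pred (ℝ^ m) 0ℓ} → (∀ {y} → V y → W y) → Nbhd x V → Nbhd x W
Nbhd-map f (e , 0<e , V⊇) = e , 0<e , λ {y} near → f {y} (V⊇ {y} near)

Nbhd-∩ : ∀ {x : ℝ^ m} {V W : Pred (ℝ^ m) 0ℓ} → Nbhd x V → Nbhd x W → Nbhd x (V ∩ W)
Nbhd-∩ (e , 0<e , V⊇) (e′ , 0<e′ , W⊇) with ℚₚ.≤-total e e′
... | inj₁ e≤e′ = e , 0<e , λ {y} near → V⊇ {y} near , W⊇ {y} λ i → ev-map (Close-mono e≤e′) (near i)
... | inj₂ e′≤e = e′ , 0<e′ , λ {y} near → V⊇ {y} (λ i → ev-map (Close-mono e′≤e) (near i)) , W⊇ {y} near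

Nbhd-U : ∀ {x : ℝ^ m} {V : Pred (ℝ^ m) 0ℓ} → (∀ y → V y) → Nbhd x V
Nbhd-U f = 1ℚ , ℚₚ.positive⁻¹ 1ℚ , λ {y} _ → f y

Nbhd-∀≤ : ∀ {x : ℝ^ m} h {V : ℕ → Pred (ℝ^ m) 0ℓ} → (∀ k → Nbhd x (V k)) → Nbhd x (λ y → ∀ k → k ≤ h → V k y)
Nbhd-∀≤ {x = x} zero {V} f = Nbhd-map {x = x} {V 0} (λ { v zero _ → v }) (f 0)
Nbhd-∀≤ {x = x} (suc h) {V} f = Nbhd-map {x = x} {V 0 ∩ λ y → ∀ k → k ≤ h → V (suc k) y}
  (λ { (v , w) zero _ → v ; (v , w) (suc k) (s≤s k≤h) → w k k≤h })
  (Nbhd-∩ {x = x} {V 0} (f 0) (Nbhd-∀≤ {x = x} h (f ∘ suc)))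

-- The box contains finitely many vectors, so this is a finite intersection, taken one coordinate at
-- a time.
Nbhd-∀-box : ∀ {x : ℝ^ m} h {V : Vec ℕ n → Pred (ℝ^ m) 0ℓ} → (∀ u → Nbhd x (V u)) →
  Nbhd x (λ y → ∀ u → (∀ i → lookup u i ≤ h) → V u y)
Nbhd-∀-box {n = zero} {x} h {V} f = Nbhd-map {x = x} {V []} (λ { v [] _ → v }) (f [])
Nbhd-∀-box {n = suc n} {x} h {V} f =
  Nbhd-map {x = x} {λ y → ∀ k → k ≤ h → ∀ u → (∀ i → lookup u i ≤ h) → V (k ∷ u) y}
    (λ { v (k ∷ u) u≤h → v k (u≤h zero) u (u≤h ∘ suc) })
    (Nbhd-∀≤ {x = x} h λ k → Nbhd-∀-box {n = n} {x} h {V ∘ (k ∷_)} (f ∘ (k ∷_)))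

common-bound : ∀ δ ε → 0ℚ ℚ.< δ → 0ℚ ℚ.< ε → ∃[ η ] 0ℚ ℚ.< η × η ℚ.≤ δ × η ℚ.≤ ε
common-bound δ ε 0<δ 0<ε with ℚₚ.≤-total δ ε
... | inj₁ δ≤ε = δ , 0<δ , ℚₚ.≤-refl , δ≤ε
... | inj₂ ε≤δ = ε , 0<ε , ε≤δ , ℚₚ.≤-refl

-- Convex sets and their connectedness

complement : ℝ → ℝ
complement t = 1ℝ +ᴿ fromℚ (ℚ.- 1ℚ) *ᴿ t

segment : ℝ^ m → ℝ^ m → ℝ → ℝ^ m
segment x y t i = complement t *ᴿ x i +ᴿ t *ᴿ y i

-- The bounds hold term by term, so convexity estimates apply at each index. Constants from the
-- rational unit interval and the limit of the bisection are of this kind.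
UnitInterval : Pred ℝ 0ℓ
UnitInterval t = ∀ n → 0ℚ ℚ.≤ seq t n × seq t n ℚ.≤ 1ℚ

segment-sum : ∀ {x y : ℝ^ m} t → sum x ≈ᴿ 1ℝ → sum y ≈ᴿ 1ℝ → sum (segment x y t) ≈ᴿ 1ℝ
segment-sum {m} {x} {y} t x-sum y-sum = affineHull-sum {m} {segment x y t}
  (2 , weight , point , point-sum , ≗⇒≈ᴿ {sum weight} {1ℝ} (λ n → weights (seq t n))
     , λ j → ≗⇒≈ᴿ {segment x y t j} {combination weight point j} λ n → pad (seq t n) (seq (x j) n) (seq (y j) n))
  where
  weight : Vector ℝ 2
  weight zero    = complement t
  weight (suc _) = t
  point : Vector (ℝ^ m) 2
  point zero    = x
  point (suc _) = y
  point-sum : ∀ i → sum (point i) ≈ᴿ 1ℝ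
  point-sum zero    = x-sum
  point-sum (suc _) = y-sum
  weights : ∀ t → (1ℚ ℚ.+ ℚ.- 1ℚ ℚ.* t) ℚ.+ (t ℚ.+ 0ℚ) ≡ 1ℚ
  weights = solve 1 (λ t → (con 1ℚ :+ con (ℚ.- 1ℚ) :* t) :+ (t :+ con 0ℚ) := con 1ℚ) refl
  pad : ∀ t x y → (1ℚ ℚ.+ ℚ.- 1ℚ ℚ.* t) ℚ.* x ℚ.+ t ℚ.* y ≡ (1ℚ ℚ.+ ℚ.- 1ℚ ℚ.* t) ℚ.* x ℚ.+ (t ℚ.* y ℚ.+ 0ℚ)
  pad = solve 3 (λ t x y → (con 1ℚ :+ con (ℚ.- 1ℚ) :* t) :* x :+ t :* y
    := (con 1ℚ :+ con (ℚ.- 1ℚ) :* t) :* x :+ (t :* y :+ con 0ℚ)) refl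

dotℚ-segment : (a : Vec ℕ m) (q r : Vector ℚ m) (s t : ℚ) →
  dotℚ a (λ i → s ℚ.* q i ℚ.+ t ℚ.* r i) ≡ s ℚ.* dotℚ a q ℚ.+ t ℚ.* dotℚ a r
dotℚ-segment a q r s t = trans (dotℚ-+ a (λ i → s ℚ.* q i) (λ i → t ℚ.* r i)) (cong₂ ℚ._+_ (dotℚ-* a s q) (dotℚ-* a t r))

-- The weights are nonnegative and sum to 1, so a margin η common to both end points survives on the
-- segment.
≺-segment : ∀ {x y : ℝ^ m} {a b} t → UnitInterval t → x ⊨ a ≺ b → y ⊨ a ≺ b → segment x y t ⊨ a ≺ b
≺-segment {m} {x} {y} {a} {b} t 0≤t≤1 x-a≺b y-a≺b =
  let δ , 0<δ , p = ≺-elim {z = x} {a} {b} x-a≺b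
      ε , 0<ε , q = ≺-elim {z = y} {a} {b} y-a≺b
      η , 0<η , η≤δ , η≤ε = common-bound δ ε 0<δ 0<ε
  in ≺-intro {z = segment x y t} {a} {b} 0<η (margins η δ ε η≤δ η≤ε (ev-∩ p q))
  where
  estimate : ∀ t η A B A′ B′ → 0ℚ ℚ.≤ t → t ℚ.≤ 1ℚ → A ℚ.+ η ℚ.≤ B → A′ ℚ.+ η ℚ.≤ B′ →
    ((1ℚ ℚ.+ ℚ.- 1ℚ ℚ.* t) ℚ.* A ℚ.+ t ℚ.* A′) ℚ.+ η ℚ.≤ (1ℚ ℚ.+ ℚ.- 1ℚ ℚ.* t) ℚ.* B ℚ.+ t ℚ.* B′
  estimate t η A B A′ B′ 0≤t t≤1 p q = begin
    (s ℚ.* A ℚ.+ t ℚ.* A′) ℚ.+ η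
      ≡⟨ solve 4 (λ t η A A′ → ((con 1ℚ :+ con (ℚ.- 1ℚ) :* t) :* A :+ t :* A′) :+ η
           := (con 1ℚ :+ con (ℚ.- 1ℚ) :* t) :* (A :+ η) :+ t :* (A′ :+ η)) refl t η A A′ ⟩
    s ℚ.* (A ℚ.+ η) ℚ.+ t ℚ.* (A′ ℚ.+ η)
      ≤⟨ ℚₚ.+-mono-≤ (*-mono-≤-nonNeg 0≤s p) (*-mono-≤-nonNeg 0≤t q) ⟩
    s ℚ.* B ℚ.+ t ℚ.* B′ ∎
    where
    open ℚₚ.≤-Reasoning
    s = 1ℚ ℚ.+ ℚ.- 1ℚ ℚ.* t
    0≤s : 0ℚ ℚ.≤ s
    0≤s = ℚ-shift-≤ {t} {1ℚ} 0ℚ s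
      (solve 1 (λ t → con 1ℚ :- t := (con 1ℚ :+ con (ℚ.- 1ℚ) :* t) :- con 0ℚ) refl t) t≤1
  pointwise : ∀ (q r : Vector ℚ m) t η → 0ℚ ℚ.≤ t → t ℚ.≤ 1ℚ → dotℚ a q ℚ.+ η ℚ.≤ dotℚ b q → dotℚ a r ℚ.+ η ℚ.≤ dotℚ b r →
    dotℚ a (λ i → (1ℚ ℚ.+ ℚ.- 1ℚ ℚ.* t) ℚ.* q i ℚ.+ t ℚ.* r i) ℚ.+ η ℚ.≤
    dotℚ b (λ i → (1ℚ ℚ.+ ℚ.- 1ℚ ℚ.* t) ℚ.* q i ℚ.+ t ℚ.* r i)
  pointwise q r t η 0≤t t≤1 p p′ = subst₂ (λ A B → A ℚ.+ η ℚ.≤ B)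
    (sym (dotℚ-segment a q r (1ℚ ℚ.+ ℚ.- 1ℚ ℚ.* t) t)) (sym (dotℚ-segment b q r (1ℚ ℚ.+ ℚ.- 1ℚ ℚ.* t) t))
    (estimate t η (dotℚ a q) (dotℚ b q) (dotℚ a r) (dotℚ b r) 0≤t t≤1 p p′)
  margins : ∀ η δ ε → η ℚ.≤ δ → η ℚ.≤ ε →
    Eventually (λ n → dotℚ a (sample x n) ℚ.+ δ ℚ.≤ dotℚ b (sample x n) × dotℚ a (sample y n) ℚ.+ ε ℚ.≤ dotℚ b (sample y n)) →
    Eventually (λ n → dotℚ a (sample (segment x y t) n) ℚ.+ η ℚ.≤ dotℚ b (sample (segment x y t) n))
  margins η δ ε η≤δ η≤ε = ev-map (λ {n} (p , q) → pointwise (sample x n) (sample y n) (seq t n) η (proj₁ (0≤t≤1 n)) (proj₂ (0≤t≤1 n))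
    (ℚₚ.≤-trans (ℚₚ.+-monoʳ-≤ (dotℚ a (sample x n)) η≤δ) p) (ℚₚ.≤-trans (ℚₚ.+-monoʳ-≤ (dotℚ a (sample y n)) η≤ε) q))

SegmentClosed : Pred (ℝ^ m) 0ℓ → Set
SegmentClosed C = ∀ {x y} t → UnitInterval t → C x → C y → C (segment x y t)

-- The index n serves both as accuracy and as the place from which terms of `t` are compared,
-- matching brackets of width ½^n.
CloseTo : Pred ℚ 0ℓ → ℝ → ℕ → Set
CloseTo P t n = ∃[ s ] 0ℚ ℚ.≤ s × s ℚ.≤ 1ℚ × P s × ∀ k → n ≤ k → Close (½^ n) (seq t k) s

-- A cover of the rationals in [0,1] by P and R decides, at each midpoint, which of
-- the two holds; the bisection converges to a point close to both P and R.
module Bisection (P R : Pred ℚ 0ℓ) (cover : ∀ s → 0ℚ ℚ.≤ s → s ℚ.≤ 1ℚ → P s ⊎ R s) where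

  record Bracket (n : ℕ) : Set where
    field
      left    : ℚ
      0≤left  : 0ℚ ℚ.≤ left
      right≤1 : left ℚ.+ ½^ n ℚ.≤ 1ℚ
      P-left  : P left
      R-right : R (left ℚ.+ ½^ n)

  open Bracket

  _Within_ : ∀ {k n} → Bracket k → Bracket n → Set
  _Within_ {k} {n} B B′ = left B′ ℚ.≤ left B × left B ℚ.+ ½^ k ℚ.≤ left B′ ℚ.+ ½^ n

  halve : ∀ {n} (B : Bracket n) → Σ[ B′ ∈ Bracket (suc n) ] B′ Within B
  halve {n} B = choose (cover mid 0≤mid mid≤1)
    where
    mid = left B ℚ.+ ½^ (suc n)
    mid+ : mid ℚ.+ ½^ (suc n) ≡ left B ℚ.+ ½^ n
    mid+ = trans (ℚₚ.+-assoc (left B) (½^ (suc n)) (½^ (suc n))) (cong (left B ℚ.+_) (½+½ (½^ n)))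
    left≤mid : left B ℚ.≤ mid
    left≤mid = subst (ℚ._≤ mid) (ℚₚ.+-identityʳ (left B)) (ℚₚ.+-monoʳ-≤ (left B) (½^-nonNeg (suc n)))
    mid≤right : mid ℚ.≤ left B ℚ.+ ½^ n
    mid≤right = ℚₚ.+-monoʳ-≤ (left B) (½^-suc-≤ n)
    0≤mid : 0ℚ ℚ.≤ mid
    0≤mid = ℚₚ.≤-trans (0≤left B) left≤mid
    mid≤1 : mid ℚ.≤ 1ℚ
    mid≤1 = ℚₚ.≤-trans mid≤right (right≤1 B)
    choose : P mid ⊎ R mid → Σ[ B′ ∈ Bracket (suc n) ] B′ Within B
    choose (inj₁ P-mid) =
        record { left = mid ; 0≤left = 0≤mid ; right≤1 = subst (ℚ._≤ 1ℚ) (sym mid+) (right≤1 B)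
               ; P-left = P-mid ; R-right = subst R (sym mid+) (R-right B) }
      , left≤mid , ℚₚ.≤-reflexive mid+
    choose (inj₂ R-mid) =
        record { left = left B ; 0≤left = 0≤left B ; right≤1 = mid≤1 ; P-left = P-left B ; R-right = R-mid }
      , ℚₚ.≤-refl , mid≤right

  module Limit (P0 : P 0ℚ) (R1 : R 1ℚ) where

    bracket : ∀ n → Bracket n
    bracket zero    = record
      { left = 0ℚ ; 0≤left = ℚₚ.≤-refl ; right≤1 = ℚₚ.≤-refl ; P-left = P0 ; R-right = R1 }
    bracket (suc n) = proj₁ (halve (bracket n))

    l r : ℕ → ℚ
    l n = left (bracket n)
    r n = l n ℚ.+ ½^ n

    nested : ∀ {n k} → n ℕ.≤′ k → l n ℚ.≤ l k × r k ℚ.≤ r n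
    nested ℕ.≤′-refl           = ℚₚ.≤-refl , ℚₚ.≤-refl
    nested (ℕ.≤′-step {k} n≤k) =
      let l≤ , ≤r = nested n≤k ; l≤′ , ≤r′ = proj₂ (halve (bracket k)) in ℚₚ.≤-trans l≤ l≤′ , ℚₚ.≤-trans ≤r′ ≤r

    l≤r : ∀ n → l n ℚ.≤ r n
    l≤r n = subst (ℚ._≤ r n) (ℚₚ.+-identityʳ (l n)) (ℚₚ.+-monoʳ-≤ (l n) (½^-nonNeg n))

    within : ∀ {n k} → n ≤ k → l n ℚ.≤ l k × l k ℚ.≤ r n
    within {n} {k} n≤k = proj₁ (nested (ℕₚ.≤⇒≤′ n≤k)) , ℚₚ.≤-trans (l≤r k) (proj₂ (nested (ℕₚ.≤⇒≤′ n≤k)))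

    l-close : ∀ {N k n} → N ≤ k → N ≤ n → Close (½^ N) (l k) (l n)
    l-close {N} N≤k N≤n =
        ℚₚ.≤-trans (proj₂ (within N≤k)) (ℚₚ.+-monoˡ-≤ (½^ N) (proj₁ (within N≤n)))
      , ℚₚ.≤-trans (proj₂ (within N≤n)) (ℚₚ.+-monoˡ-≤ (½^ N) (proj₁ (within N≤k)))

    r-close : ∀ {k n} → n ≤ k → Close (½^ n) (l k) (r n)
    r-close {k} {n} n≤k =
        ℚₚ.≤-trans (proj₂ (within n≤k)) (subst (ℚ._≤ r n ℚ.+ ½^ n) (ℚₚ.+-identityʳ (r n)) (ℚₚ.+-monoʳ-≤ (r n) (½^-nonNeg n)))
      , ℚₚ.+-monoˡ-≤ (½^ n) (proj₁ (within n≤k))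

    limit : ℝ
    limit = mkℝ l λ ε 0<ε → let N , small = ½^-eventually-≤ (½-pos 0<ε) in
      N , λ k n N≤k N≤n → ℚₚ.≤-<-trans (Close⇒∣-∣≤ (l k) (l n) (l-close N≤k N≤n))
                            (ℚₚ.≤-<-trans (small N ℕₚ.≤-refl) (½-< 0<ε))

    limit-unit : UnitInterval limit
    limit-unit n = 0≤left (bracket n) , ℚₚ.≤-trans (l≤r n) (right≤1 (bracket n))

  bisect : P 0ℚ → R 1ℚ → ∃[ t ] UnitInterval t × ∀ n → CloseTo P t n × CloseTo R t n
  bisect P0 R1 = limit , limit-unit , λ n →
      (l n , 0≤left (bracket n) , ℚₚ.≤-trans (l≤r n) (right≤1 (bracket n)) , P-left (bracket n) , λ k n≤k → l-close n≤k ℕₚ.≤-refl)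
    , (r n , ℚₚ.≤-trans (0≤left (bracket n)) (l≤r n) , right≤1 (bracket n) , R-right (bracket n) , λ k n≤k → r-close n≤k)
    where open Limit P0 R1

-- Changing the parameter from t to s moves coordinate i by (yᵢ - xᵢ)(t - s), and each yᵢ - xᵢ is
-- eventually bounded; n is chosen to serve all coordinates at once.
segment-close : ∀ {x y : ℝ^ m} (t : ℝ) e → 0ℚ ℚ.< e →
  ∃[ n ] ∀ s → (∀ k → n ≤ k → Close (½^ n) (seq t k) s) → Near e (segment x y t) (segment x y (fromℚ s))
segment-close {m} {x} {y} t e 0<e = let n , small = ev-witness (ev-∀ (λ i → ½^-eventually-≤ (0<δ i))) in
  n , λ s close i → near n s close i (small i)
  where
  difference : Fin m → ℝ
  difference i = y i +ᴿ fromℚ (ℚ.- 1ℚ) *ᴿ x i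
  K : Fin m → ℚ
  K i = proj₁ (eventually-bounded (difference i))
  0<K : ∀ i → 0ℚ ℚ.< K i
  0<K i = proj₁ (proj₂ (eventually-bounded (difference i)))
  scaled : ∀ i → ∃[ δ ] 0ℚ ℚ.< δ × K i ℚ.* δ ℚ.≤ e
  scaled i = ∃-small-multiple (ℚₚ.<⇒≤ (0<K i)) 0<e
  δ : Fin m → ℚ
  δ i = proj₁ (scaled i)
  0<δ : ∀ i → 0ℚ ℚ.< δ i
  0<δ i = proj₁ (proj₂ (scaled i))
  moved : ∀ t s x y → (y ℚ.+ ℚ.- 1ℚ ℚ.* x) ℚ.* (t ℚ.- s) ≡
    ((1ℚ ℚ.+ ℚ.- 1ℚ ℚ.* t) ℚ.* x ℚ.+ t ℚ.* y) ℚ.- ((1ℚ ℚ.+ ℚ.- 1ℚ ℚ.* s) ℚ.* x ℚ.+ s ℚ.* y)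
  moved = solve 4 (λ t s x y → (y :+ con (ℚ.- 1ℚ) :* x) :* (t :- s) :=
    ((con 1ℚ :+ con (ℚ.- 1ℚ) :* t) :* x :+ t :* y) :- ((con 1ℚ :+ con (ℚ.- 1ℚ) :* s) :* x :+ s :* y)) refl
  estimate : ∀ {K δ} t s x y → ∣ y ℚ.+ ℚ.- 1ℚ ℚ.* x ∣ ℚ.≤ K → Close δ t s → K ℚ.* δ ℚ.≤ e →
    Close e ((1ℚ ℚ.+ ℚ.- 1ℚ ℚ.* t) ℚ.* x ℚ.+ t ℚ.* y) ((1ℚ ℚ.+ ℚ.- 1ℚ ℚ.* s) ℚ.* x ℚ.+ s ℚ.* y)
  estimate {K} {δ} t s x y bound close Kδ≤e = ∣-∣≤⇒Close
    ((1ℚ ℚ.+ ℚ.- 1ℚ ℚ.* t) ℚ.* x ℚ.+ t ℚ.* y) ((1ℚ ℚ.+ ℚ.- 1ℚ ℚ.* s) ℚ.* x ℚ.+ s ℚ.* y)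
    (subst (λ d → ∣ d ∣ ℚ.≤ e) (moved t s x y)
      (ℚₚ.≤-trans (∣p*q∣≤ (y ℚ.+ ℚ.- 1ℚ ℚ.* x) (t ℚ.- s) bound (Close⇒∣-∣≤ t s close)) Kδ≤e))
  near : ∀ n s → (∀ k → n ≤ k → Close (½^ n) (seq t k) s) → ∀ i → ½^ n ℚ.≤ δ i →
    Eventually (λ k → Close e (seq (segment x y t i) k) (seq (segment x y (fromℚ s) i) k))
  near n s close i small = ev-map
    (λ {k} (bound , near-s) → estimate {K i} {δ i} (seq t k) s (seq (x i) k) (seq (y i) k) (ℚₚ.<⇒≤ bound)
       (Close-mono {½^ n} {δ i} {seq t k} {s} small near-s) (proj₂ (proj₂ (scaled i))))
    (ev-∩ (proj₂ (proj₂ (eventually-bounded (difference i)))) (n , close))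

-- A predicate may distinguish points with the same terms, but an open one cannot, since such points
-- lie in each other's neighbourhoods. The segment at parameters 0 and 1 agrees with its end points
-- only in this sense.
open-resp-≗ : ∀ {x y : ℝ^ m} {V} → Open V → V x → (∀ i n → seq (x i) n ≡ seq (y i) n) → V y
open-resp-≗ {x = x} {y} {V} V-open Vx x≗y =
  let e , 0<e , V⊇ = Open⇒Nbhd {V = V} {x} (λ {z} → V-open {z}) Vx
  in V⊇ {y} λ i → 0 , λ n _ →
       subst (Close e (seq (x i) n)) (x≗y i n) (ℚₚ.<⇒≤ (p<p+ε (seq (x i) n) 0<e) , ℚₚ.<⇒≤ (p<p+ε (seq (x i) n) 0<e))

module _ {C V W : Pred (ℝ^ m) 0ℓ} (C-closed : SegmentClosed C)
         (V-open : Open V) (W-open : Open W) (cover : ∀ z → C z → V z ⊎ W z)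
         (x y : ℝ^ m) (Cx : C x) (Vx : V x) (Cy : C y) (Wy : W y) where

  private
    point : ℚ → ℝ^ m
    point s = segment x y (fromℚ s)

    C-point : ∀ s → 0ℚ ℚ.≤ s → s ℚ.≤ 1ℚ → C (point s)
    C-point s 0≤s s≤1 = C-closed {x} {y} (fromℚ s) (λ _ → 0≤s , s≤1) Cx Cy

    at-0 : ∀ x y → x ≡ (1ℚ ℚ.+ ℚ.- 1ℚ ℚ.* 0ℚ) ℚ.* x ℚ.+ 0ℚ ℚ.* y
    at-0 = solve 2 (λ x y → x := (con 1ℚ :+ con (ℚ.- 1ℚ) :* con 0ℚ) :* x :+ con 0ℚ :* y) refl

    at-1 : ∀ x y → y ≡ (1ℚ ℚ.+ ℚ.- 1ℚ ℚ.* 1ℚ) ℚ.* x ℚ.+ 1ℚ ℚ.* y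
    at-1 = solve 2 (λ x y → y := (con 1ℚ :+ con (ℚ.- 1ℚ) :* con 1ℚ) :* x :+ con 1ℚ :* y) refl

    V-0 : V (point 0ℚ)
    V-0 = open-resp-≗ {x = x} {point 0ℚ} {V} (λ {z} → V-open {z}) Vx λ i n → at-0 (seq (x i) n) (seq (y i) n)

    W-1 : W (point 1ℚ)
    W-1 = open-resp-≗ {x = y} {point 1ℚ} {W} (λ {z} → W-open {z}) Wy λ i n → at-1 (seq (x i) n) (seq (y i) n)

    meets-nbhd : ∀ {U P} t → (∀ n → CloseTo P t n) → Nbhd (segment x y t) U →
      ∃[ s ] 0ℚ ℚ.≤ s × s ℚ.≤ 1ℚ × P s × U (point s)
    meets-nbhd {U} {P} t approx (e , 0<e , U⊇) = extract (segment-close {x = x} {y} t e 0<e)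
      where
      extract : (∃[ n ] ∀ s → (∀ k → n ≤ k → Close (½^ n) (seq t k) s) → Near e (segment x y t) (point s)) →
        ∃[ s ] 0ℚ ℚ.≤ s × s ℚ.≤ 1ℚ × P s × U (point s)
      extract (n , near) = let s , 0≤s , s≤1 , Ps , close = approx n in
        s , 0≤s , s≤1 , Ps , U⊇ {point s} (near s close)

    -- If the limit lies in `V`, then so does a neighbourhood of it, which contains points of `W`
    -- approximating the limit; the other case is symmetric.
    overlap-at : ∀ t → (∀ n → CloseTo (λ s → V (point s)) t n) → (∀ n → CloseTo (λ s → W (point s)) t n) →
      V (segment x y t) ⊎ W (segment x y t) → ∃[ z ] (C ∩ (V ∩ W)) z
    overlap-at t V-approx W-approx (inj₁ V-limit) =
      let s , 0≤s , s≤1 , Ws , Vs = meets-nbhd {V} {λ s → W (point s)} t W-approx (Open⇒Nbhd {V = V} {segment x y t} (λ {z} → V-open {z}) V-limit)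
      in point s , C-point s 0≤s s≤1 , Vs , Ws
    overlap-at t V-approx W-approx (inj₂ W-limit) =
      let s , 0≤s , s≤1 , Vs , Ws = meets-nbhd {W} {λ s → V (point s)} t V-approx (Open⇒Nbhd {V = W} {segment x y t} (λ {z} → W-open {z}) W-limit)
      in point s , C-point s 0≤s s≤1 , Vs , Ws

  cover-overlaps : ∃[ z ] (C ∩ (V ∩ W)) z
  cover-overlaps =
    let t , t-unit , approx = Bisection.bisect (λ s → V (point s)) (λ s → W (point s))
                                (λ s 0≤s s≤1 → cover (point s) (C-point s 0≤s s≤1)) V-0 W-1
    in overlap-at t (λ n → proj₁ (approx n)) (λ n → proj₂ (approx n)) (cover (segment x y t) (C-closed {x} {y} t t-unit Cx Cy))

segmentClosed⇒connected : {C : Pred (ℝ^ m) 0ℓ} → SegmentClosed C → Connected C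
segmentClosed⇒connected {C = C} C-closed V W V-open W-open cover (x , Cx , Vx) (y , Cy , Wy) empty =
  let z , CVW = cover-overlaps {C = C} {V} {W} (λ {x} {y} → C-closed {x} {y}) (λ {x} → V-open {x}) (λ {x} → W-open {x})
                  (λ z → cover {z}) x y Cx Vx Cy Wy
  in empty z CVW

-- Comparable pairs and edges

all-zero⇒𝟎 : (a : Vec ℕ m) → (∀ i → lookup a i ≡ 0) → a ≡ 𝟎
all-zero⇒𝟎 []      _  = refl
all-zero⇒𝟎 (x ∷ a) eq = cong₂ _∷_ (eq zero) (all-zero⇒𝟎 a (eq ∘ suc))

zero? : (a : Vec ℕ m) → (∃[ i ] lookup a i ≡ 0) ⊎ (∀ i → lookup a i ≢ 0)
zero? a with any? (λ i → lookup a i ℕₚ.≟ 0)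
... | yes z = inj₁ z
... | no ¬z = inj₂ λ i eq → ¬z (i , eq)

≢𝟎⇒supp : (a : Vec ℕ m) → a ≢ 𝟎 → ∃ (supp a)
≢𝟎⇒supp a a≢𝟎 with any? (λ i → ¬? (lookup a i ℕₚ.≟ 0))
... | yes s = s
... | no ¬s = contradiction (all-zero⇒𝟎 a λ i → decide i (lookup a i ℕₚ.≟ 0)) a≢𝟎
  where
  decide : ∀ i → Dec (lookup a i ≡ 0) → lookup a i ≡ 0
  decide i (yes eq) = eq
  decide i (no neq) = contradiction (i , neq) ¬s

Comparable : ℕ → Vec ℕ m → Vec ℕ m → Set
Comparable h a b = a ≢ b × climb a ℕ.+ climb b ≤ h

Comparable-sym : ∀ {h} {a b : Vec ℕ m} → Comparable h a b → Comparable h b a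
Comparable-sym {h = h} {a} {b} (a≢b , ≤h) = a≢b ∘ sym , subst (_≤ h) (ℕₚ.+-comm (climb a) (climb b)) ≤h

Comparable? : ∀ h (a b : Vec ℕ m) → Dec (Comparable h a b)
Comparable? h a b = ¬? (Vecₚ.≡-dec ℕₚ._≟_ a b) ×-dec (climb a ℕ.+ climb b ℕₚ.≤? h)

Edge-sym : ∀ {h} {u v : Vec ℕ m} → Edge h u v → Edge h v u
Edge-sym {h = h} (Mu , Mv , u≢v , a , b , c , u≡ , v≡ , disjoint , ≤h) =
  Mv , Mu , u≢v ∘ sym , b , a , c , v≡ , u≡ , (λ i (p , q) → disjoint i (q , p)) ,
  subst (_≤ h) (ℕₚ.+-comm (climb a) (climb b)) ≤h

-- Translation by `c` only enlarges the common part: the disjoint parts remain `a ⊖ b` and `b ⊖ a`,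
-- whose climbs are controlled by `climb-⊖`.
Comparable⇒Edge-⊕ : ∀ {h} {a b : Vec ℕ m} → Comparable h a b → ∀ c → M h (a ⊕ c) → M h (b ⊕ c) → Edge h (a ⊕ c) (b ⊕ c)
Comparable⇒Edge-⊕ {a = a} {b} (a≢b , ≤h) c Mac Mbc =
    Mac , Mbc , a≢b ∘ ⊕-cancelʳ c , a ⊖ b , b ⊖ a , (a ⊓⃗ b) ⊕ c
  , trans (cong (_⊕ c) (⊖-⊓ a b)) (⊕-assoc (a ⊖ b) (a ⊓⃗ b) c)
  , trans (cong (_⊕ c) (trans (⊖-⊓ b a) (cong ((b ⊖ a) ⊕_) (⊓-comm⃗ b a)))) (⊕-assoc (b ⊖ a) (a ⊓⃗ b) c)
  , ⊖-disjoint a b , ℕₚ.≤-trans (climb-⊖ a b) ≤h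

Comparable⇒Edge : ∀ {h} {a b : Vec ℕ m} → Comparable h a b → Edge h a b
Comparable⇒Edge {h = h} {a} {b} cmp@(_ , ≤h) = subst₂ (Edge h) (⊕-identityʳ a) (⊕-identityʳ b)
  (Comparable⇒Edge-⊕ cmp 𝟎 (subst (M h) (sym (⊕-identityʳ a)) (ℕₚ.m+n≤o⇒m≤o (climb a) ≤h))
                           (subst (M h) (sym (⊕-identityʳ b)) (ℕₚ.m+n≤o⇒n≤o (climb a) ≤h)))

Edge⇒Comparable : ∀ {h} {u v : Vec ℕ m} → Edge h u v →
  ∃[ a ] ∃[ b ] ∃[ c ] u ≡ a ⊕ c × v ≡ b ⊕ c × Comparable h a b
Edge⇒Comparable (_ , _ , u≢v , a , b , c , u≡ , v≡ , _ , ≤h) =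
  a , b , c , u≡ , v≡ , (λ a≡b → u≢v (trans u≡ (trans (cong (_⊕ c) a≡b) (sym v≡)))) , ≤h

-- Equations of the arrangement

sideSum : List (Subset m) → ℝ^ m → ℝ
sideSum L z = List.foldr (λ S s → subsetSum S z +ᴿ s) 0ℝ L

seq-subsetSum : (S : Subset m) (z : ℝ^ m) → ∀ n → seq (subsetSum S z) n ≡ dotℚ (ind S) (sample z n)
seq-subsetSum {m} S z n = trans (seq-sum {m} (λ j → if lookup S j then z j else 0ℝ) n) (sum-cong-≗ {m} λ j →
  trans (summand (lookup S j) (z j)) (cong (_×ℚ seq (z j) n) (sym (Vecₚ.lookup-map j _ S))))
  where
  summand : ∀ s x → seq (if s then x else 0ℝ) n ≡ (if s then 1 else 0) ×ℚ seq x n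
  summand inside  x = sym (ℚₚ.+-identityʳ (seq x n))
  summand outside x = refl

seq-sideSum : (L : List (Subset m)) (z : ℝ^ m) → ∀ n → seq (sideSum L z) n ≡ dotℚ (coef L) (sample z n)
seq-sideSum []      z n = sym (dotℚ-𝟎 (sample z n))
seq-sideSum (S ∷ L) z n =
  trans (cong₂ ℚ._+_ (seq-subsetSum S z n) (seq-sideSum L z n)) (sym (dotℚ-⊕ (ind S) (coef L) (sample z n)))

seq-sideSum-dot : (L : List (Subset m)) (z : ℝ^ m) → ∀ n → seq (sideSum L z) n ≡ seq (dot (coef L) z) n
seq-sideSum-dot L z n = trans (seq-sideSum L z n) (sym (seq-dot (coef L) z n))

sideSum⇒≺ : ∀ {z : ℝ^ m} (L L′ : List (Subset m)) → sideSum L z <ᴿ sideSum L′ z → z ⊨ coef L ≺ coef L′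
sideSum⇒≺ {z = z} L L′ = <ᴿ-resp {sideSum L z} {sideSum L′ z} {dot (coef L) z} {dot (coef L′) z}
  (seq-sideSum-dot L z) (seq-sideSum-dot L′ z)

≺⇒sideSum : ∀ {z : ℝ^ m} (L L′ : List (Subset m)) → z ⊨ coef L ≺ coef L′ → sideSum L z <ᴿ sideSum L′ z
≺⇒sideSum {z = z} L L′ = <ᴿ-resp {dot (coef L) z} {dot (coef L′) z} {sideSum L z} {sideSum L′ z}
  (λ n → sym (seq-sideSum-dot L z n)) (λ n → sym (seq-sideSum-dot L′ z n))

-- For distinct p and q, taking ε = |p - q| would give |p - q| < |p - q|.
constant-≈ᴿ : ∀ {x y} p q → (∀ n → seq x n ≡ p) → (∀ n → seq y n ≡ q) → x ≈ᴿ y → p ≡ q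
constant-≈ᴿ {x} {y} p q x≡p y≡q x≈y = decide (p ℚₚ.≟ q)
  where
  decide : Dec (p ≡ q) → p ≡ q
  decide (yes p≡q) = p≡q
  decide (no p≢q)  = contradiction refl-< (ℚₚ.<-irrefl refl)
    where
    0<d : 0ℚ ℚ.< ∣ p ℚ.- q ∣
    0<d = ℚₚ.≰⇒> λ d≤0 → p≢q (p-q≡0⇒p≡q (ℚₚ.∣p∣≡0⇒p≡0 (p ℚ.- q) (ℚₚ.≤-antisym d≤0 (ℚₚ.0≤∣p∣ (p ℚ.- q)))))
      where
      p-q≡0⇒p≡q : p ℚ.- q ≡ 0ℚ → p ≡ q
      p-q≡0⇒p≡q eq = trans (solve 2 (λ p q → p := (p :- q) :+ q) refl p q) (trans (cong (ℚ._+ q) eq) (ℚₚ.+-identityˡ q))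
    refl-< : ∣ p ℚ.- q ∣ ℚ.< ∣ p ℚ.- q ∣
    refl-< = let n , lt = ev-witness (x≈y ∣ p ℚ.- q ∣ 0<d) in
      subst (ℚ._< ∣ p ℚ.- q ∣) (cong₂ (λ s t → ∣ s ℚ.- t ∣) (x≡p n) (y≡q n)) lt

nondegenerate⇒≢ : ∀ {h} (E : Equation m h) → Nondegenerate E → coef (Equation.left E) ≢ coef (Equation.right E)
nondegenerate⇒≢ E nd eq = nd λ z → ≗⇒≈ᴿ {lhs z} {rhs z} λ n →
  trans (seq-sideSum left z n) (trans (cong (λ a → dotℚ a (sample z n)) eq) (sym (seq-sideSum right z n)))
  where open Equation E

-- At rational points both sides are constant sequences, so an identity between reals there is one
-- between rationals and determines the coefficients.
≢⇒nondegenerate : ∀ {h} (E : Equation m h) → coef (Equation.left E) ≢ coef (Equation.right E) → Nondegenerate E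
≢⇒nondegenerate E a≢b same = a≢b (dotℚ-injective (coef left) (coef right) λ q →
  constant-≈ᴿ {lhs (fromℚ ∘ q)} {rhs (fromℚ ∘ q)} (dotℚ (coef left) q) (dotℚ (coef right) q)
    (seq-sideSum left (fromℚ ∘ q)) (seq-sideSum right (fromℚ ∘ q)) (same (fromℚ ∘ q)))
  where open Equation E

≺-equation : ∀ {h} {z : ℝ^ m} {a b i j} → Q m h z → Comparable h a b → lookup a i ≡ 0 → lookup b j ≡ 0 →
  z ⊨ a ≺ b ⊎ z ⊨ b ≺ a
≺-equation {m} {h} {z} {a} {b} (_ , avoids) (a≢b , ≤h) aᵢ≡0 bⱼ≡0 =
  go (decompose-proper a aᵢ≡0) (decompose-proper b bⱼ≡0)
  where
  go : _ → _ → z ⊨ a ≺ b ⊎ z ⊨ b ≺ a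
  go (L , L-ok , |L| , refl) (L′ , L′-ok , |L′| , refl) =
    Sum.map (sideSum⇒≺ {z = z} L L′) (sideSum⇒≺ {z = z} L′ L) (avoids E (≢⇒nondegenerate E a≢b))
    where
    E : Equation m h
    E = record { left = L ; right = L′ ; left-ok = L-ok ; right-ok = L′-ok
               ; bound = subst₂ (λ k k′ → k ℕ.+ k′ ≤ h) (sym |L|) (sym |L′|) ≤h }

-- Signs on Q

≺-unit⇒0< : ∀ {z : ℝ^ m} i → z ⊨ 𝟎 ≺ unit i → 0ℝ <ᴿ z i
≺-unit⇒0< {z = z} i = <ᴿ-resp {dot 𝟎 z} {dot (unit i) z} {0ℝ} {z i}
  (λ n → trans (seq-dot 𝟎 z n) (dotℚ-𝟎 (sample z n))) (λ n → trans (seq-dot (unit i) z n) (dotℚ-unit i (sample z n)))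

unit≺⇒<0 : ∀ {z : ℝ^ m} i → z ⊨ unit i ≺ 𝟎 → z i <ᴿ 0ℝ
unit≺⇒<0 {z = z} i = <ᴿ-resp {dot (unit i) z} {dot 𝟎 z} {z i} {0ℝ}
  (λ n → trans (seq-dot (unit i) z n) (dotℚ-unit i (sample z n))) (λ n → trans (seq-dot 𝟎 z n) (dotℚ-𝟎 (sample z n)))

Positive : Pred (ℝ^ m) 0ℓ
Positive z = ∀ i → 0ℝ <ᴿ z i

positive⇒𝟎≺ : ∀ {z : ℝ^ m} {a i} → Positive z → lookup a i ≢ 0 → z ⊨ 𝟎 ≺ a
positive⇒𝟎≺ {m} {z} {a} {i} 0<z aᵢ≢0 = let δ , 0<δ , ev = 0<z i in
  ≺-intro {z = z} {𝟎} {a} 0<δ (ev-map (λ {n} (p , q) → pointwise (sample z n) δ p q) (ev-∩ ev (ev-∀ nonNeg)))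
  where
  nonNeg : ∀ j → Eventually (λ n → 0ℚ ℚ.≤ seq (z j) n)
  nonNeg j = let δ , 0<δ , ev = 0<z j in
    ev-map (λ p → ℚₚ.≤-trans (ℚₚ.<⇒≤ 0<δ) (ℚₚ.≤-trans (ℚₚ.≤-reflexive (sym (ℚₚ.+-identityˡ δ))) (ℚₚ.<⇒≤ p))) ev
  pointwise : ∀ (q : Vector ℚ m) δ → 0ℚ ℚ.+ δ ℚ.< q i → (∀ j → 0ℚ ℚ.≤ q j) → dotℚ 𝟎 q ℚ.+ δ ℚ.≤ dotℚ a q
  pointwise q δ p 0≤q = ℚₚ.≤-trans (ℚₚ.≤-reflexive (cong (ℚ._+ δ) (dotℚ-𝟎 q)))
    (ℚₚ.≤-trans (ℚₚ.<⇒≤ p) (dotℚ-lower a 0≤q i aᵢ≢0))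

comparable-unit : ∀ {h} → 1 ≤ h → (i : Fin m) → Comparable h 𝟎 (unit i)
comparable-unit {m} {h} 1≤h i = unit≢𝟎 i , subst₂ (λ k k′ → k ℕ.+ k′ ≤ h) (sym (climb-𝟎 m 0)) (sym (climb-unit i)) 1≤h

unit-zero : (i : Fin (suc (suc m))) → ∃[ j ] lookup (unit i) j ≡ 0
unit-zero zero    = suc zero , refl
unit-zero (suc i) = zero , refl

≈ᴿ1⇒0< : ∀ {x} → x +ᴿ 0ℝ ≈ᴿ 1ℝ → 0ℝ <ᴿ x
≈ᴿ1⇒0< {x} x≈1 = <ᴿ-intro {0ℝ} {x} (ℚₚ.positive⁻¹ ½)
  (ev-map (λ {n} p → bound (seq x n) (ℚₚ.<⇒≤ p)) (x≈1 ½ (ℚₚ.positive⁻¹ ½)))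
  where
  bound : ∀ p → ∣ (p ℚ.+ 0ℚ) ℚ.- 1ℚ ∣ ℚ.≤ ½ → 0ℚ ℚ.+ ½ ℚ.≤ p
  bound p d≤½ = ℚ-shift-≤ {1ℚ} {(p ℚ.+ 0ℚ) ℚ.+ ½} (0ℚ ℚ.+ ½) p
    (solve 1 (λ p → ((p :+ con 0ℚ) :+ con ½) :- con 1ℚ := p :- (con 0ℚ :+ con ½)) refl p)
    (proj₂ (∣-∣≤⇒Close (p ℚ.+ 0ℚ) 1ℚ d≤½))

-- For m = 1 there are no proper consecutive subsets, and positivity comes from the coordinate sum
-- 1. Otherwise the hyperplane zᵢ = 0 belongs to the arrangement, and the simplex excludes its
-- negative side.
Q⇒positive : ∀ {h} → 1 ≤ h → {z : ℝ^ m} → Q m h z → Positive z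
Q⇒positive {suc zero}    1≤h {z} ((_ , z-sum) , _) zero = ≈ᴿ1⇒0< {z zero} z-sum
Q⇒positive {suc (suc m)} {h} 1≤h {z} Qz@((0≤z , _) , _) i = choose
  (≺-equation {z = z} {𝟎} {unit i} {zero} {proj₁ (unit-zero i)} Qz (comparable-unit 1≤h i) refl (proj₂ (unit-zero i)))
  where
  choose : z ⊨ 𝟎 ≺ unit i ⊎ z ⊨ unit i ≺ 𝟎 → 0ℝ <ᴿ z i
  choose (inj₁ p) = ≺-unit⇒0< {z = z} i p
  choose (inj₂ p) = contradiction (unit≺⇒<0 {z = z} i p) (0≤z i)

Q⇒compares-disjoint : ∀ {h} → 1 ≤ m → 1 ≤ h → {z : ℝ^ m} → Q m h z → ∀ {a b} → Comparable h a b →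
  U.Empty (supp a ∩ supp b) → z ⊨ a ≺ b ⊎ z ⊨ b ≺ a
Q⇒compares-disjoint {suc m} {h} _ 1≤h {z} Qz {a} {b} cmp disjoint = go (zero? a) (zero? b)
  where
  full : ∀ a b → (∀ i → lookup a i ≢ 0) → U.Empty (supp a ∩ supp b) → z ⊨ b ≺ a
  full a b a≢0 disjoint = subst (λ b → z ⊨ b ≺ a) (sym b≡𝟎) (positive⇒𝟎≺ {z = z} {a} {zero} (Q⇒positive 1≤h {z} Qz) (a≢0 zero))
    where
    zero-at : ∀ i → Dec (lookup b i ≡ 0) → lookup b i ≡ 0
    zero-at i (yes eq) = eq
    zero-at i (no neq) = contradiction (a≢0 i , neq) (disjoint i)
    b≡𝟎 : b ≡ 𝟎
    b≡𝟎 = all-zero⇒𝟎 b λ i → zero-at i (lookup b i ℕₚ.≟ 0)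
  go : _ → _ → z ⊨ a ≺ b ⊎ z ⊨ b ≺ a
  go (inj₁ (i , aᵢ≡0)) (inj₁ (j , bⱼ≡0)) = ≺-equation {z = z} {a} {b} {i} {j} Qz cmp aᵢ≡0 bⱼ≡0
  go (inj₂ a≢0)        _                 = inj₂ (full a b a≢0 disjoint)
  go _                 (inj₂ b≢0)        = inj₁ (full b a b≢0 λ i (p , q) → disjoint i (q , p))

Q⇒compares : ∀ {h} → 1 ≤ m → 1 ≤ h → {z : ℝ^ m} → Q m h z → ∀ {a b} → Comparable h a b → z ⊨ a ≺ b ⊎ z ⊨ b ≺ a
Q⇒compares {h = h} 1≤m 1≤h {z} Qz {a} {b} (a≢b , ≤h) = subst₂ (λ u v → z ⊨ u ≺ v ⊎ z ⊨ v ≺ u) (sym a≡) (sym b≡)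
  (Sum.map (≺-⊕ {z = z} {a ⊖ b} {b ⊖ a} c) (≺-⊕ {z = z} {b ⊖ a} {a ⊖ b} c)
    (Q⇒compares-disjoint 1≤m 1≤h {z} Qz {a ⊖ b} {b ⊖ a} (≢ , ℕₚ.≤-trans (climb-⊖ a b) ≤h) (⊖-disjoint a b)))
  where
  c = a ⊓⃗ b
  a≡ : a ≡ (a ⊖ b) ⊕ c
  a≡ = ⊖-⊓ a b
  b≡ : b ≡ (b ⊖ a) ⊕ c
  b≡ = trans (⊖-⊓ b a) (cong ((b ⊖ a) ⊕_) (⊓-comm⃗ b a))
  ≢ : a ⊖ b ≢ b ⊖ a
  ≢ eq = a≢b (trans a≡ (trans (cong (_⊕ c) eq) (sym b≡)))

φ-⊕ : ∀ {h} {z : ℝ^ m} {u v a b c} → Edge h u v → u ≡ a ⊕ c → v ≡ b ⊕ c → z ⊨ a ≺ b → φ h z u v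
φ-⊕ {z = z} {a = a} {b} {c} edge refl refl a≺b = edge , ≺-⊕ {z = z} {a} {b} c a≺b

-- Orientations and regions

module _ {m h} (1≤m : 1 ≤ m) (1≤h : 1 ≤ h) where

  φ-total : ∀ {z : ℝ^ m} → Q m h z → ∀ {u v} → Edge h u v → φ h z u v ⊎ φ h z v u
  φ-total {z} Qz {u} {v} edge =
    let a , b , c , u≡ , v≡ , cmp = Edge⇒Comparable edge
    in Sum.map (φ-⊕ {z = z} {u} {v} {a} {b} {c} edge u≡ v≡) (φ-⊕ {z = z} {v} {u} {b} {a} {c} (Edge-sym edge) v≡ u≡)
         (Q⇒compares 1≤m 1≤h {z} Qz cmp)

  φ-orientation : ∀ {z} → Q m h z → IsOrientation m h (φ h z)
  φ-orientation {z} Qz = record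
    { edge  = proj₁
    ; total = φ-total {z} Qz
    ; asym  = λ {u} {v} (_ , u≺v) (_ , v≺u) → <ᴿ-asym {dot u z} {dot v z} u≺v v≺u
    }

  φ-coherent : ∀ {z} → Q m h z → IsCoherent m h (φ h z)
  φ-coherent {z} Qz = record
    { fromZero  = λ {u} edge@(_ , _ , 𝟎≢u , _) →
        let i , uᵢ≢0 = ≢𝟎⇒supp u (𝟎≢u ∘ sym) in edge , positive⇒𝟎≺ {z = z} {u} {i} (Q⇒positive 1≤h {z} Qz) uᵢ≢0
    ; translate = λ {a} {b} {c} a≢b ≤h Mac Mbc → mk⇔
        (λ (_ , ac≺bc) → Comparable⇒Edge (a≢b , ≤h) , ≺-⊕⁻¹ {z = z} {a} {b} c ac≺bc)
        (λ (_ , a≺b) → Comparable⇒Edge-⊕ (a≢b , ≤h) c Mac Mbc , ≺-⊕ {z = z} {a} {b} c a≺b)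
    }

  -- The source of acyclicity: the value of the form at z strictly increases along a walk, so no
  -- walk closes up.
  φ-walk : ∀ {z : ℝ^ m} {u v} → TransClosure (φ h z) u v → z ⊨ u ≺ v
  φ-walk [ (_ , u≺v) ] = u≺v
  φ-walk {z} {u} {v} (_∷_ {y = w} (_ , u≺w) walk) =
    <ᴿ-trans {dot u z} {dot w z} {dot v z} u≺w (φ-walk {z} {w} {v} walk)

  φ-coherentAcyclicOrientation : ∀ z → Q m h z → IsCoherentAcyclicOrientation m h (φ h z)
  φ-coherentAcyclicOrientation z Qz =
    φ-orientation {z} Qz , φ-coherent {z} Qz , λ {u} cycle → <ᴿ-irrefl {dot u z} (φ-walk {z} {u} {u} cycle)

  -- For an edge uv, the sets where u ≺ v and where v ≺ u are open and disjoint
  -- and cover Q, so a connected subset of Q lies in one of them.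
  sameRegion⇒φ⊆ : ∀ (z w : ℝ^ m) → SameRegion m h z w → ∀ {u v} → φ h z u v → φ h w u v
  sameRegion⇒φ⊆ z w (C , C⊆Q , connected , Cz , Cw) {u} {v} (edge , u≺v) = choose (φ-total {w} (C⊆Q {w} Cw) edge)
    where
    cover : ∀ {x} → C x → x ⊨ u ≺ v ⊎ x ⊨ v ≺ u
    cover {x} Cx = Sum.map proj₂ proj₂ (φ-total {x} (C⊆Q {x} Cx) edge)
    choose : φ h w u v ⊎ φ h w v u → φ h w u v
    choose (inj₁ u⟶v)       = u⟶v
    choose (inj₂ (_ , v≺u)) = contradiction
      (λ x (_ , u≺v , v≺u) → <ᴿ-asym {dot u x} {dot v x} u≺v v≺u)
      (connected (_⊨ u ≺ v) (_⊨ v ≺ u) (λ {x} → Open-≺ u v {x}) (λ {x} → Open-≺ v u {x}) (λ {x} → cover {x})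
        (z , Cz , u≺v) (w , Cw , v≺u))

  -- One direction suffices: for z in `Q` one of the two signs holds for every comparable pair, so
  -- all signs at y are determined.
  SameSigns : ℝ^ m → ℝ^ m → Set
  SameSigns z y = ∀ a b → Comparable h a b → z ⊨ a ≺ b → y ⊨ a ≺ b

  φ⊆⇒sameSigns : ∀ (z w : ℝ^ m) → (∀ {u v} → φ h z u v → φ h w u v) → SameSigns z w
  φ⊆⇒sameSigns z w φ⊆ a b cmp a≺b = proj₂ (φ⊆ {a} {b} (Comparable⇒Edge cmp , a≺b))

  sameSigns-compares : ∀ {z y : ℝ^ m} → Q m h z → SameSigns z y → ∀ {a b} → Comparable h a b → y ⊨ a ≺ b ⊎ y ⊨ b ≺ a
  sameSigns-compares {z} Qz same {a} {b} cmp =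
    Sum.map (same a b cmp) (same b a (Comparable-sym cmp)) (Q⇒compares 1≤m 1≤h {z} Qz cmp)

  -- The pairs of `𝟎` and a unit vector give nonnegativity, and by `climb-coef` the two sides of
  -- each nondegenerate equation form a comparable pair. Only the coordinate sum has to be supplied
  -- separately.
  sameSigns⇒Q : ∀ {z y : ℝ^ m} → Q m h z → sum y ≈ᴿ 1ℝ → SameSigns z y → Q m h y
  sameSigns⇒Q {z} {y} Qz y-sum same = (nonNeg , y-sum) , avoids
    where
    nonNeg : ∀ i → 0ℝ ≤ᴿ y i
    nonNeg i = <ᴿ-asym {0ℝ} {y i} (≺-unit⇒0< {z = y} i
      (same 𝟎 (unit i) (comparable-unit 1≤h i) (positive⇒𝟎≺ {z = z} {unit i} {proj₁ s} (Q⇒positive 1≤h {z} Qz) (proj₂ s))))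
      where
      s = ≢𝟎⇒supp (unit i) (unit≢𝟎 i ∘ sym)
    avoids : (E : Equation m h) → Nondegenerate E → Equation.lhs E y # Equation.rhs E y
    avoids E nd = Sum.map (≺⇒sideSum {z = y} left right) (≺⇒sideSum {z = y} right left)
      (sameSigns-compares {z} {y} Qz same
        (nondegenerate⇒≢ E nd , ℕₚ.≤-trans (ℕₚ.+-mono-≤ (climb-coef left left-ok) (climb-coef right right-ok)) bound))
      where open Equation E

  -- Every edge is a translate of a comparable pair. The backward direction follows from the forward
  -- one: if z oriented the edge oppositely, then so would y.
  sameSigns⇒φ⇔ : ∀ {z y : ℝ^ m} → Q m h z → SameSigns z y → φ h z ⇔ φ h y
  sameSigns⇒φ⇔ {z} {y} Qz same = (λ {u} {v} → to {u} {v}) , (λ {u} {v} → from {u} {v})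
    where
    to : ∀ {u v} → φ h z u v → φ h y u v
    to {u} {v} (edge , u≺v) =
      let a , b , c , u≡ , v≡ , cmp = Edge⇒Comparable edge
      in φ-⊕ {z = y} {u} {v} {a} {b} {c} edge u≡ v≡
           (same a b cmp (≺-⊕⁻¹ {z = z} {a} {b} c (subst₂ (z ⊨_≺_) u≡ v≡ u≺v)))
    from : ∀ {u v} → φ h y u v → φ h z u v
    from {u} {v} (edge , u≺v) = choose (φ-total {z} Qz edge)
      where
      choose : φ h z u v ⊎ φ h z v u → φ h z u v
      choose (inj₁ u⟶v) = u⟶v
      choose (inj₂ v⟶u) = contradiction (proj₂ (to {v} {u} v⟶u)) (<ᴿ-asym {dot u y} {dot v y} u≺v)

  φ⇔-sym : ∀ (z w : ℝ^ m) → φ h z ⇔ φ h w → φ h w ⇔ φ h z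
  φ⇔-sym z w (f , g) = (λ {u} {v} → g {u} {v}) , (λ {u} {v} → f {u} {v})

  φ⇔-trans : ∀ (x y z : ℝ^ m) → φ h x ⇔ φ h y → φ h y ⇔ φ h z → φ h x ⇔ φ h z
  φ⇔-trans x y z (f , g) (f′ , g′) = (λ {u} {v} r → f′ {u} {v} (f {u} {v} r)) , (λ {u} {v} r → g {u} {v} (g′ {u} {v} r))

  -- `SameRegion` lives one universe level higher and cannot itself serve as the connected set; this
  -- set, convex by `cell-segmentClosed`, takes its place.
  Cell : ℝ^ m → Pred (ℝ^ m) 0ℓ
  Cell z x = Q m h x × φ h z ⇔ φ h x

  cell-segmentClosed : ∀ z → SegmentClosed (Cell z)
  cell-segmentClosed z {x} {y} t t-unit (Qx , zx) (Qy , zy) =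
      sameSigns⇒Q {x} {segment x y t} Qx (segment-sum {x = x} {y} t (proj₂ (proj₁ Qx)) (proj₂ (proj₁ Qy))) same
    , φ⇔-trans z x (segment x y t) zx (sameSigns⇒φ⇔ {x} {segment x y t} Qx same)
    where
    same : SameSigns x (segment x y t)
    same a b cmp x-a≺b = ≺-segment {x = x} {y} {a} {b} t t-unit x-a≺b
      (φ⊆⇒sameSigns x y (λ {u} {v} → proj₁ (φ⇔-trans x z y (φ⇔-sym z x zx) zy) {u} {v}) a b cmp x-a≺b)

  φ⇔⇒sameRegion : ∀ z w → Q m h z → Q m h w → φ h z ⇔ φ h w → SameRegion m h z w
  φ⇔⇒sameRegion z w Qz Qw zw =
    Cell z , proj₁ , segmentClosed⇒connected {C = Cell z} (λ {x} {y} → cell-segmentClosed z {x} {y}) ,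
    (Qz , (λ r → r) , (λ r → r)) , (Qw , (λ {u} {v} → proj₁ zw {u} {v}) , (λ {u} {v} → proj₂ zw {u} {v}))

  sameRegion-sym : ∀ (z w : ℝ^ m) → SameRegion m h z w → SameRegion m h w z
  sameRegion-sym z w (C , C⊆Q , connected , Cz , Cw) = C , (λ {x} → C⊆Q {x}) , connected , Cw , Cz

  sameRegion⇒φ⇔ : ∀ (z w : ℝ^ m) → SameRegion m h z w → φ h z ⇔ φ h w
  sameRegion⇒φ⇔ z w zw =
    (λ {u} {v} → sameRegion⇒φ⊆ z w zw {u} {v}) , (λ {u} {v} → sameRegion⇒φ⊆ w z (sameRegion-sym z w zw) {u} {v})

  sameRegion⇒Q : ∀ (z w : ℝ^ m) → SameRegion m h z w → Q m h w
  sameRegion⇒Q z w (C , C⊆Q , _ , _ , Cw) = C⊆Q {w} Cw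

  sameRegion-cong : ∀ (z z′ : ℝ^ m) → Q m h z → φ h z ⇔ φ h z′ → ∀ {w} → SameRegion m h z′ w → SameRegion m h z w
  sameRegion-cong z z′ Qz zz′ {w} z′w = φ⇔⇒sameRegion z w Qz (sameRegion⇒Q z′ w z′w)
    (φ⇔-trans z z′ w zz′ (sameRegion⇒φ⇔ z′ w z′w))

  -- Comparable vectors have entries at most `h`, which leaves a finite box. Comparability is
  -- decidable and the sign at z is known, so the condition for each pair is either vacuous or open.
  sameSigns-nbhd : ∀ {z} → Q m h z → Nbhd z (SameSigns z)
  sameSigns-nbhd {z} Qz = Nbhd-map {x = z} {λ y → ∀ a → (∀ i → lookup a i ≤ h) → ∀ b → (∀ i → lookup b i ≤ h) → V a b y}
    (λ v a b cmp@(_ , ≤h) → v a (λ i → ℕₚ.≤-trans (lookup≤climbFrom 0 a i) (ℕₚ.m+n≤o⇒m≤o (climb a) ≤h))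
                              b (λ i → ℕₚ.≤-trans (lookup≤climbFrom 0 b i) (ℕₚ.m+n≤o⇒n≤o (climb a) ≤h)) cmp)
    (Nbhd-∀-box {x = z} h λ a → Nbhd-∀-box {x = z} h {V a} λ b → local a b (Comparable? h a b))
    where
    V : Vec ℕ m → Vec ℕ m → Pred (ℝ^ m) 0ℓ
    V a b y = Comparable h a b → z ⊨ a ≺ b → y ⊨ a ≺ b
    local : ∀ a b → Dec (Comparable h a b) → Nbhd z (V a b)
    local a b (no ¬cmp) = Nbhd-U {x = z} {V a b} λ y cmp → contradiction cmp ¬cmp
    local a b (yes cmp) = choose (Q⇒compares 1≤m 1≤h {z} Qz cmp)
      where
      choose : z ⊨ a ≺ b ⊎ z ⊨ b ≺ a → Nbhd z (V a b)
      choose (inj₁ a≺b) = Nbhd-map {x = z} {_⊨ a ≺ b} {V a b} (λ p _ _ → p) (Nbhd-≺ {x = z} {a} {b} a≺b)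
      choose (inj₂ b≺a) = Nbhd-U {x = z} {V a b} λ y _ a≺b → contradiction b≺a (<ᴿ-asym {dot a z} {dot b z} a≺b)

  region∋ : ∀ {R : Pred (ℝ^ m) (lsuc 0ℓ)} z → Q m h z → R U.≐ SameRegion m h z → R z
  region∋ z Qz (_ , R⊇) = R⊇ {z} (φ⇔⇒sameRegion z z Qz Qz ((λ r → r) , (λ r → r)))

  -- Points of the affine hull have coordinate sum 1, and those near z share its signs, hence lie in
  -- `Q` and in its region.
  region-relativeInterior : ∀ {R : Pred (ℝ^ m) (lsuc 0ℓ)} z → Q m h z → R U.≐ SameRegion m h z → RelativeInterior R z
  region-relativeInterior {R} z Qz R≐@(R⊆ , R⊇) =
    let ε , 0<ε , ball⊆ = Nbhd⇒Ball {x = z} {SameSigns z} (sameSigns-nbhd {z} Qz)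
    in region∋ {R} z Qz R≐ , ε , 0<ε , λ {y} (y-hull , y-ball) → same⇒R y (hull-sum y y-hull) (ball⊆ {y} y-ball)
    where
    hull-sum : ∀ y → AffineHull R y → sum y ≈ᴿ 1ℝ
    hull-sum y (k , t , p , Rp , t-sum , y≈) = affineHull-sum {m} {y}
      (k , t , p , (λ i → proj₂ (proj₁ (sameRegion⇒Q z (p i) (R⊆ {p i} (Rp i))))) , t-sum , y≈)
    same⇒R : ∀ y → sum y ≈ᴿ 1ℝ → SameSigns z y → R y
    same⇒R y y-sum same = R⊇ {y} (φ⇔⇒sameRegion z y Qz (sameSigns⇒Q {z} {y} Qz y-sum same) (sameSigns⇒φ⇔ {z} {y} Qz same))

  relativeInterior-mono : ∀ {R S : Pred (ℝ^ m) (lsuc 0ℓ)} → R U.≐ S → ∀ {x} → RelativeInterior R x → RelativeInterior S x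
  relativeInterior-mono (R⊆S , S⊆R) {x} (Rx , ε , 0<ε , ball⊆) =
    R⊆S {x} Rx , ε , 0<ε , λ {y} ((k , t , p , Sp , t-sum , y≈) , ball) →
      R⊆S {y} (ball⊆ {y} ((k , t , p , (λ i → S⊆R {p i} (Sp i)) , t-sum , y≈) , ball))

  -- Open regions and the injection

  basePoint : ∀ {O} → IsOpenRegion m h O → ∃ (Q m h)
  basePoint (_ , (z , Qz , _) , _) = z , Qz

  openRegion∋⇒sameRegion : ∀ {O} (o : IsOpenRegion m h O) → ∀ w → O w → SameRegion m h (proj₁ (basePoint o)) w
  openRegion∋⇒sameRegion (R , (z , _ , (R⊆ , _)) , (O⊆ , _)) w Ow = R⊆ {w} (proj₁ (O⊆ {w} Ow))

  openRegion∋point : ∀ {O} (o : IsOpenRegion m h O) → O (proj₁ (basePoint o))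
  openRegion∋point (R , (z , Qz , R≐) , (_ , O⊇)) = O⊇ {z} (region-relativeInterior {R} z Qz R≐)

  openRegion-unique : ∀ {O O′} (o : IsOpenRegion m h O) (o′ : IsOpenRegion m h O′) →
    φ h (proj₁ (basePoint o)) ⇔ φ h (proj₁ (basePoint o′)) → O U.≐ O′
  openRegion-unique {O} {O′} (R , (z , Qz , R≐) , O≐) (R′ , (z′ , Qz′ , R′≐) , O′≐) zz′ =
    ≐-trans {i = O} {RelativeInterior R} {O′} O≐
      (≐-trans {i = RelativeInterior R} {RelativeInterior R′} {O′}
        ((λ {x} → relativeInterior-mono {R} {R′} R≐R′ {x}) , (λ {x} → relativeInterior-mono {R′} {R} (≐-sym {x = R} {R′} R≐R′) {x}))
        (≐-sym {x = O′} {RelativeInterior R′} O′≐))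
    where
    R≐R′ : R U.≐ R′
    R≐R′ = (λ {x} Rx → proj₂ R′≐ {x} (sameRegion-cong z′ z Qz′ (φ⇔-sym z z′ zz′) {x} (proj₁ R≐ {x} Rx)))
         , (λ {x} R′x → proj₂ R≐ {x} (sameRegion-cong z z′ Qz zz′ {x} (proj₁ R′≐ {x} R′x)))

  -- The base point of the first open region lies in it, hence in the second, and thus in the region
  -- of the second base point.
  openRegion-φ : ∀ {O O′} (o : IsOpenRegion m h O) (o′ : IsOpenRegion m h O′) → O U.≐ O′ →
    φ h (proj₁ (basePoint o)) ⇔ φ h (proj₁ (basePoint o′))
  openRegion-φ o o′ (O⊆O′ , _) = φ⇔-sym (proj₁ (basePoint o′)) (proj₁ (basePoint o))
    (sameRegion⇒φ⇔ (proj₁ (basePoint o′)) (proj₁ (basePoint o))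
      (openRegion∋⇒sameRegion o′ (proj₁ (basePoint o)) (O⊆O′ {proj₁ (basePoint o)} (openRegion∋point o))))

  orientation : ∃ (IsOpenRegion m h) → ∃ (IsCoherentAcyclicOrientation m h)
  orientation (O , o) = φ h (proj₁ (basePoint o)) , φ-coherentAcyclicOrientation (proj₁ (basePoint o)) (proj₂ (basePoint o))

  orientation-injection : Injection (openRegions m h) (coherentAcyclicOrientations m h)
  orientation-injection = record
    { to        = orientation
    ; cong      = λ {x} {y} → openRegion-φ (proj₂ x) (proj₂ y)
    ; injective = λ {x} {y} → openRegion-unique (proj₂ x) (proj₂ y)
    }

theorem5p7 : ∀ (m h : ℕ) → 1 ≤ m → 2 ≤ h →
    (∀ z → Q m h z → IsCoherentAcyclicOrientation m h (φ h z))
    × (∀ z w → Q m h z → Q m h w → SameRegion m h z w → φ h z ⇔ φ h w)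
    × (∀ z w → Q m h z → Q m h w → φ h z ⇔ φ h w → SameRegion m h z w)
    × (Σ[ Φ ∈ Injection (openRegions m h) (coherentAcyclicOrientations m h) ]
    (∀ O z → proj₁ O z → proj₁ (Injection.to Φ O) ⇔ φ h z))
theorem5p7 m h 1≤m 2≤h =
    φ-coherentAcyclicOrientation 1≤m 1≤h
  , (λ z w _ _ → sameRegion⇒φ⇔ 1≤m 1≤h z w)
  , φ⇔⇒sameRegion 1≤m 1≤h
  , orientation-injection 1≤m 1≤h
  , λ (O , o) z Oz → sameRegion⇒φ⇔ 1≤m 1≤h (proj₁ (basePoint 1≤m 1≤h o)) z (openRegion∋⇒sameRegion 1≤m 1≤h o z Oz)
  where
  1≤h : 1 ≤ h
  1≤h = ℕₚ.≤-trans (s≤s z≤n) 2≤h
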